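{- Let $\Gamma\vdash t:A$ be a derivable typing judgement of the annotated language. Then there is a unique $u$ (up to renaming of bound variables) such that $\Gamma\vdash_e u:A$ and $[\![t]\!]=[\![u]\!]$, where $[\![-]\!]$ denotes the interpretation in the model $\mathsf{Circ}$.
   Context: Fix a set $\mathbf{Q}$ of qubits and a set $\mathbf{G}$ of gates; each gate $G$ comes with a tuple $(q_1,\dots,q_n)$ of distinct qubits and a duration $d_G\in\mathbb{R}_{\ge0}$; write $(G,d_G,q_1,\dots,q_n)\in\mathbf{G}$. **Annotated language.** Types: $A,B::=1\mid q\mid A\otimes B\mid \Box_d A$ ($q\in\mathbf{Q}$, $d\in\mathbb{R}$). Contexts: lists of graded declarations $x:^d A$ with distinct variables, $d\in\mathbb{R}$. $d+\Gamma$ adds $d$ to every grade of $\Gamma$. Typing rules: - Swap: from $\Gamma,x:^dA,y:^eB,\Delta\vdash t:C$ infer $\Gamma,y:^eB,x:^dA,\Delta\vdash t:C$. - Var: $x:^0A\vdash x:A$. Unit-I: $\vdash *:1$. - Unit-E: from $\Gamma\vdash s:1$, $\Delta\vdash t:A$ infer $d+\Gamma,\Delta\vdash\mathrm{let}\ *=s\ \mathrm{in}\ t:A$ ($d$ any real). - Gate: for $(G,d,q_1,\dots,q_n)\in\mathbf{G}$, from $\Gamma_i\vdash t_i:q_i$ infer $-d+\Gamma_1,\dots,-d+\Gamma_n\vdash G(t_1,\dots,t_n):q_1\otimes\cdots\otimes q_n$. - Tens-I: from $\Gamma\vdash s:A$, $\Delta\vdash t:B$ infer $\Gamma,\Delta\vdash(s,t):A\otimes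 B$. - Tens-E: from $\Gamma\vdash s:A\otimes B$ and $x:^dA,y:^dB,\Delta\vdash t:C$ infer $d+\Gamma,\Delta\vdash\mathrm{let}\ (x,y)=s\ \mathrm{in}\ t:C$. - Box-I: from $\Gamma\vdash t:A$ infer $d+\Gamma\vdash\mathrm{box}\ d\ t:\Box_dA$. - Box-E: from $\Gamma\vdash s:\Box_dA$ and $x:^eA,\Delta\vdash t:B$ infer $(e-d)+\Gamma,\Delta\vdash\mathrm{let\ box}\ d\ x=s\ \mathrm{in}\ t:B$. - Delay: from $\Gamma\vdash t:q$, $d\ge0$ infer $-d+\Gamma\vdash\mathrm{delay}_d(t):q$. - Let: from $\Gamma\vdash s:A$ and $x:^dA,\Delta\vdash t:C$ infer $d+\Gamma,\Delta\vdash\mathrm{let}\ x=s\ \mathrm{in}\ t:C$. **The category $\mathsf{Circ}$.** The strict symmetric monoidal category freely generated as follows. Objects are finite sequences of elements of $\mathbb{R}\times\mathbf{Q}$ (equivalently, contexts all of whose types are qubits, forgetting variable names), with tensor given by concatenation and unit the empty sequence. Morphisms are generated under composition and tensor by permutations (the symmetries), delays $\mathrm{delay}_d:[(x,q)]\to[(x+d,q)]$ for $q\in\mathbf{Q}$, $x\in\mathbb{R}$, $d\ge0$, and gates $\phi_G:[(x,q_1),\dots,(x,q_n)]\to[(x+d,q_1),\dots,(x+d,q_n)]$ for $(G,d,q_1,\dots,q_n)\in\mathbf{G}$, $x\in\mathbb{R}$, subject only to the axioms of strict symmetric monoidal categories. $\mathrm{Shift}(d)$ is the strict symmetric monoidal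 endofunctor adding $d$ to every time, fixing permutations and sending delays and gates to the correspondingly shifted ones. Write $\Gamma\multimap_G\Delta$ for its homsets. Each morphism has an underlying permutation matching positions of its source with positions of its target (delays and gates act as the identity permutation); accordingly, for a morphism $c:\Theta\multimap_G\Delta$ between qubit-only contexts, the variable names of $\Delta$ are those of $\Theta$, transported along this permutation. **Interpretation in $\mathsf{Circ}$.** $[\![1]\!]=[]$, $[\![q]\!]=[(0,q)]$, $[\![A\otimes B]\!]$ is the concatenation of $[\![A]\!]$ and $[\![B]\!]$, $[\![\Box_dA]\!]=\mathrm{Shift}(d)[\![A]\!]$; $[\![x_1:^{d_1}A_1,\dots,x_n:^{d_n}A_n]\!]$ is the concatenation of the $\mathrm{Shift}(d_i)[\![A_i]\!]$, so $[\![d+\Gamma]\!]=\mathrm{Shift}(d)[\![\Gamma]\!]$. A derivation of $\Gamma\vdash t:A$ is interpreted as a morphism $[\![t]\!]:[\![\Gamma]\!]\multimap_G[\![A]\!]$: Swap is precomposition with the symmetry; Var and Unit-I are identities; Unit-E is $\mathrm{Shift}(d)[\![s]\!]\otimes[\![t]\!]$; Tens-I is $[\![s]\!]\otimes[\![t]\!]$; Tens-E and Let are $[\![t]\!]\circ(\mathrm{Shift}(d)[\![s]\!]\otimes\mathrm{id})$; Gate is $\phi_G\circ\mathrm{Shift}(-d)(\bigotimes_i[\![t_i]\!])$ (with $\phi_G$ starting at time $-d$); Delay is $\mathrm{delay}_d\circ\mathrm{Shift}(-d)[\![t]\!]$ (starting at time $-d$); Box-I is $\mathrm{Shift}(d)[\![t]\!]$;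 Box-E is $[\![t]\!]\circ(\mathrm{Shift}(e-d)[\![s]\!]\otimes\mathrm{id})$. **Normal forms.** The judgements $\Gamma\vdash_n t:A$ and $\Gamma\vdash_e t:A$ are generated by the following rules, where $\Theta$ always denotes a context containing only qubit types (so eliminators act only on the first non-qubit variable): - $\vdash_n *:1$; $x:^0q\vdash_n x:q$ for $q\in\mathbf{Q}$; from $\Gamma\vdash_n s:A$, $\Delta\vdash_n t:B$ infer $\Gamma,\Delta\vdash_n(s,t):A\otimes B$; from $\Gamma\vdash_n t:A$ infer $d+\Gamma\vdash_n\mathrm{box}\ d\ t:\Box_dA$. - from $\Theta,\Delta\vdash_e t:A$ infer $\Theta,x:^d1,\Delta\vdash_e\mathrm{let}\ *=x\ \mathrm{in}\ t:A$. - from $\Theta,x:^dA,y:^dB,\Delta\vdash_e t:C$ infer $\Theta,z:^d(A\otimes B),\Delta\vdash_e\mathrm{let}\ (x,y)=z\ \mathrm{in}\ t:C$. - from $\Theta,x:^{d+e}A,\Delta\vdash_e t:B$ infer $\Theta,z:^d\Box_eA,\Delta\vdash_e\mathrm{let\ box}\ e\ x=z\ \mathrm{in}\ t:B$. - Circ: from $\Delta\vdash_n t:B$ and a morphism $c:\Theta\multimap_G\Delta$ of $\mathsf{Circ}$ infer $\Theta\vdash_e t\ \mathsf{after}\ c:B$. All these terms are interpreted in $\mathsf{Circ}$ as in the annotated language, with $[\![t\ \mathsf{after}\ c]\!]:=[\![t]\!]\circ c$. -}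

module Defs where

open import Algebra.Structures using (IsCommutativeRing)
open import Data.List using (List; []; _∷_; [_]; _++_; _∷ʳ_; map)
open import Data.List.Properties using (++-assoc; ++-identityʳ; map-++; map-∘; map-cong; map-id; ∷ʳ-++)
open import Data.List.Relation.Binary.Permutation.Propositional using (↭⇒↭ₛ)
import Data.List.Relation.Binary.Permutation.Propositional.Properties as Perm
import Data.List.Relation.Binary.Permutation.Setoid.Properties as PermSetoid
open import Data.List.Relation.Binary.Pointwise using (Pointwise)
open import Data.List.Relation.Unary.All using (All; []; _∷_)
open import Data.List.Relation.Unary.All.Properties using (++⁺; ++⁻ˡ; ++⁻ʳ; map⁺; map⁻)
open import Data.List.Relation.Unary.Unique.Propositional using (Unique)
open import Data.Nat using (ℕ)
open import Data.Product using (∃; ∃-syntax; _×_; _,_; map₁)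
open import Relation.Binary.PropositionalEquality
  using (_≡_; _≢_; refl; sym; trans; cong; cong₂; subst; setoid)
open import Relation.Binary.Structures using (IsTotalOrder)

-- The field ℝ, given by its characterisation (up to unique isomorphism) as
-- the Dedekind-complete totally ordered field.
record RealNumbers : Set₁ where
  infix  8 -_
  infixl 7 _*_
  infixl 6 _+_
  infix  4 _≤_
  field
    ℝ                 : Set
    _+_ _*_           : ℝ → ℝ → ℝ
    -_                : ℝ → ℝ
    0# 1#             : ℝ
    _≤_               : ℝ → ℝ → Set
    isCommutativeRing : IsCommutativeRing _≡_ _+_ _*_ -_ 0# 1#
    0≢1               : 0# ≢ 1#
    inverse           : ∀ x → x ≢ 0# → ∃[ y ] x * y ≡ 1#
    isTotalOrder      : IsTotalOrder _≡_ _≤_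
    +-monoʳ-≤         : ∀ x {y z} → y ≤ z → x + y ≤ x + z
    *-nonneg          : ∀ {x y} → 0# ≤ x → 0# ≤ y → 0# ≤ x * y

  UpperBound : (ℝ → Set) → ℝ → Set
  UpperBound P b = ∀ x → P x → x ≤ b

  field
    supremum : (P : ℝ → Set) → ∃ P → ∃ (UpperBound P) →
               ∃[ s ] UpperBound P s × (∀ b → UpperBound P b → s ≤ b)

  open IsCommutativeRing isCommutativeRing public
    using (+-assoc; +-comm; +-identityˡ; +-identityʳ; -‿inverseˡ; -‿inverseʳ)

  infixl 6 _-_
  _-_ : ℝ → ℝ → ℝ
  x - y = x + (- y)

record GateSet (ℛ : RealNumbers) : Set₁ where
  open RealNumbers ℛ
  field
    Qubit      : Set
    Gate       : Set
    duration   : Gate → ℝ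
    duration≥0 : ∀ G → 0# ≤ duration G
    qubits     : Gate → List Qubit
    distinct   : ∀ G → Unique (qubits G)

module Language (ℛ : RealNumbers) (𝒮 : GateSet ℛ) where
  open RealNumbers ℛ
  open GateSet 𝒮

  Name : Set
  Name = ℕ

  Obj : Set
  Obj = List (ℝ × Qubit)

  at : ℝ → List Qubit → Obj
  at x = map (x ,_)

  infixr 9 _∘_
  infixr 6 _⊗₁_
  infix  4 _≈_

  -- Formal composites of the generators; equality of morphisms is _≈_ below.
  data Hom : Obj → Obj → Set where
    id    : ∀ {a} → Hom a a
    _∘_   : ∀ {a b c} → Hom b c → Hom a b → Hom a c
    _⊗₁_  : ∀ {a b a′ b′} → Hom a b → Hom a′ b′ → Hom (a ++ a′) (b ++ b′)
    σ     : ∀ a b → Hom (a ++ b) (b ++ a)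
    delay : ∀ d → .(0# ≤ d) → ∀ x q → Hom [ (x , q) ] [ (x + d , q) ]
    φ     : ∀ G x → Hom (at x (qubits G)) (at (x + duration G) (qubits G))

  -- The congruence generated by the axioms of strict symmetric monoidal
  -- categories.  The strictness axioms relate arrows whose endpoints are
  -- equal only propositionally, so the endpoints are indices on both sides;
  -- f ≈ g nevertheless forces the endpoints of f and g to be equal.
  data _≈_ : ∀ {a b a′ b′} → Hom a b → Hom a′ b′ → Set where
    ≈-refl  : ∀ {a b} {f : Hom a b} → f ≈ f
    ≈-sym   : ∀ {a b a′ b′} {f : Hom a b} {g : Hom a′ b′} → f ≈ g → g ≈ f
    ≈-trans : ∀ {a b a′ b′ a″ b″} {f : Hom a b} {g : Hom a′ b′} {h : Hom a″ b″} →
              f ≈ g → g ≈ h → f ≈ h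

    ∘-cong  : ∀ {a b c a′ b′ c′} {f : Hom a b} {g : Hom b c} {f′ : Hom a′ b′} {g′ : Hom b′ c′} →
              g ≈ g′ → f ≈ f′ → g ∘ f ≈ g′ ∘ f′
    ⊗-cong  : ∀ {a b c d a′ b′ c′ d′} {f : Hom a b} {g : Hom c d} {f′ : Hom a′ b′} {g′ : Hom c′ d′} →
              f ≈ f′ → g ≈ g′ → f ⊗₁ g ≈ f′ ⊗₁ g′

    identityˡ : ∀ {a b} {f : Hom a b} → id ∘ f ≈ f
    identityʳ : ∀ {a b} {f : Hom a b} → f ∘ id ≈ f
    assoc     : ∀ {a b c d} {f : Hom a b} {g : Hom b c} {h : Hom c d} →
                (h ∘ g) ∘ f ≈ h ∘ (g ∘ f)

    ⊗-id        : ∀ {a b} → id {a} ⊗₁ id {b} ≈ id {a ++ b}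
    ⊗-∘         : ∀ {a b c a′ b′ c′} {f : Hom a b} {g : Hom b c} {f′ : Hom a′ b′} {g′ : Hom b′ c′} →
                  (g ∘ f) ⊗₁ (g′ ∘ f′) ≈ (g ⊗₁ g′) ∘ (f ⊗₁ f′)
    ⊗-identityˡ : ∀ {a b} {f : Hom a b} → id {[]} ⊗₁ f ≈ f
    ⊗-identityʳ : ∀ {a b} {f : Hom a b} → f ⊗₁ id {[]} ≈ f
    ⊗-assoc     : ∀ {a b c d a′ b′} {f : Hom a b} {g : Hom c d} {h : Hom a′ b′} →
                  (f ⊗₁ g) ⊗₁ h ≈ f ⊗₁ (g ⊗₁ h)

    σ-natural    : ∀ {a b a′ b′} {f : Hom a b} {g : Hom a′ b′} →
                   σ b b′ ∘ (f ⊗₁ g) ≈ (g ⊗₁ f) ∘ σ a a′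
    σ-involutive : ∀ {a b} → σ b a ∘ σ a b ≈ id {a ++ b}
    -- The axiom σ a (b ++ c) = (id ⊗₁ σ a c) ∘ (σ a b ⊗₁ id), with its two
    -- factors given up to reassociation of their endpoints.
    σ-hexagon    : ∀ {a b c x y z} {f : Hom x y} {g : Hom y z} →
                   f ≈ σ a b ⊗₁ id {c} → g ≈ id {b} ⊗₁ σ a c →
                   σ a (b ++ c) ≈ g ∘ f

  cast : ∀ {a a′ b b′} → a ≡ a′ → b ≡ b′ → Hom a b → Hom a′ b′
  cast refl refl f = f

  Shift : ℝ → Obj → Obj
  Shift d = map (map₁ (d +_))

  Shift-++ : ∀ d a b → Shift d (a ++ b) ≡ Shift d a ++ Shift d b
  Shift-++ d a b = map-++ _ a b

  Shift-0 : ∀ a → Shift 0# a ≡ a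
  Shift-0 a = trans (map-cong (λ (x , q) → cong (_, q) (+-identityˡ x)) a) (map-id a)

  Shift-Shift : ∀ d e a → Shift d (Shift e a) ≡ Shift (d + e) a
  Shift-Shift d e a =
    trans (sym (map-∘ a)) (map-cong (λ (x , q) → cong (_, q) (sym (+-assoc d e x))) a)

  Shift-at : ∀ d x qs → Shift d (at x qs) ≡ at (d + x) qs
  Shift-at d x qs = sym (map-∘ qs)

  Shift₁ : ∀ d {a b} → Hom a b → Hom (Shift d a) (Shift d b)
  Shift₁ d id = id
  Shift₁ d (g ∘ f) = Shift₁ d g ∘ Shift₁ d f
  Shift₁ d (_⊗₁_ {a} {b} {a′} {b′} f g) =
    cast (sym (Shift-++ d a a′)) (sym (Shift-++ d b b′)) (Shift₁ d f ⊗₁ Shift₁ d g)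
  Shift₁ d (σ a b) =
    cast (sym (Shift-++ d a b)) (sym (Shift-++ d b a)) (σ (Shift d a) (Shift d b))
  Shift₁ d (delay e e≥0 x q) =
    cast refl (cong (λ y → [ (y , q) ]) (+-assoc d x e)) (delay e e≥0 (d + x) q)
  Shift₁ d (φ G x) =
    cast (sym (Shift-at d x qs))
         (trans (cong (λ y → at y qs) (+-assoc d x (duration G)))
                (sym (Shift-at d (x + duration G) qs)))
         (φ G (d + x))
    where qs = qubits G

  Names : Obj → Set
  Names = All (λ _ → Name)

  -- The action on names of the underlying permutation of a morphism.
  transport : ∀ {a b} → Hom a b → Names a → Names b
  transport id ns = ns
  transport (g ∘ f) ns = transport g (transport f ns)
  transport (_⊗₁_ {a} f g) ns = ++⁺ (transport f (++⁻ˡ a ns)) (transport g (++⁻ʳ a ns))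
  transport (σ a b) ns = ++⁺ (++⁻ʳ a ns) (++⁻ˡ a ns)
  transport (delay d d≥0 x q) (n ∷ []) = n ∷ []
  transport (φ G x) ns = map⁺ (map⁻ ns)

  infixr 7 _⊗_
  data Type : Set where
    𝟙     : Type
    qubit : Qubit → Type
    _⊗_   : Type → Type → Type
    □     : ℝ → Type → Type

  -- Bracketed to the right; the empty product is 𝟙 and ⨂ [ q ] is qubit q.
  ⨂ : List Qubit → Type
  ⨂ []           = 𝟙
  ⨂ (q ∷ [])     = qubit q
  ⨂ (q ∷ r ∷ qs) = qubit q ⊗ ⨂ (r ∷ qs)

  infix 6 _∶⟨_⟩_
  record Declaration : Set where
    constructor _∶⟨_⟩_
    field
      name  : Name
      grade : ℝ
      type  : Type
  open Declaration public

  Context : Set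
  Context = List Declaration

  Distinct : Context → Set
  Distinct Γ = Unique (map name Γ)

  infixr 6 _+ᶜ_
  _+ᶜ_ : ℝ → Context → Context
  d +ᶜ Γ = map (λ (x ∶⟨ e ⟩ A) → x ∶⟨ d + e ⟩ A) Γ

  -- The qubit-only context with underlying object a and variables ns.
  qctx : (a : Obj) → Names a → Context
  qctx [] [] = []
  qctx ((d , q) ∷ a) (x ∷ ns) = x ∶⟨ d ⟩ qubit q ∷ qctx a ns

  data Lang : Set where
    annotated extended : Lang

  infix 5 _after_
  data Term : Lang → Set where
    var         : ∀ {l} → Name → Term l
    ⋆           : ∀ {l} → Term l
    let⋆        : ∀ {l} → Term l → Term l → Term l
    gate        : ∀ {l} → Gate → List (Term l) → Term l
    pair        : ∀ {l} → Term l → Term l → Term l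
    letp        : ∀ {l} → Name → Name → Term l → Term l → Term l
    box         : ∀ {l} → ℝ → Term l → Term l
    letbox      : ∀ {l} → ℝ → Name → Term l → Term l → Term l
    delay       : ∀ {l} → ℝ → Term l → Term l
    let′        : ∀ {l} → Name → Term l → Term l → Term l
    _after_     : ∀ {a b} → Term extended → Hom a b → Term extended

  -- α-equivalence.  A list of pairs of names records the binders crossed so
  -- far on either side, innermost first.
  Binders : Set
  Binders = List (Name × Name)

  infix 4 _⊢ᵛ_≈_ _⊢_≈α_ _=α_

  data _⊢ᵛ_≈_ : Binders → Name → Name → Set where
    free  : ∀ {x} → [] ⊢ᵛ x ≈ x
    here  : ∀ {ρ x y} → (x , y) ∷ ρ ⊢ᵛ x ≈ y
    there : ∀ {ρ x y x′ y′} → x ≢ x′ → y ≢ y′ → ρ ⊢ᵛ x ≈ y → (x′ , y′) ∷ ρ ⊢ᵛ x ≈ y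

  -- In `t after c` the morphism c has no variable names, and it only matters
  -- as a morphism of Circ, that is, up to _≈_.
  data _⊢_≈α_ (ρ : Binders) : ∀ {l} → Term l → Term l → Set where
    var    : ∀ {l x y} → ρ ⊢ᵛ x ≈ y → ρ ⊢ var {l} x ≈α var y
    ⋆      : ∀ {l} → ρ ⊢ ⋆ {l} ≈α ⋆
    let⋆   : ∀ {l} {s t s′ t′ : Term l} → ρ ⊢ s ≈α s′ → ρ ⊢ t ≈α t′ →
             ρ ⊢ let⋆ s t ≈α let⋆ s′ t′
    gate   : ∀ {l G} {ts ts′ : List (Term l)} → Pointwise (ρ ⊢_≈α_) ts ts′ →
             ρ ⊢ gate G ts ≈α gate G ts′
    pair   : ∀ {l} {s t s′ t′ : Term l} → ρ ⊢ s ≈α s′ → ρ ⊢ t ≈α t′ →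
             ρ ⊢ pair s t ≈α pair s′ t′
    letp   : ∀ {l x y x′ y′} {s t s′ t′ : Term l} → ρ ⊢ s ≈α s′ →
             (y , y′) ∷ (x , x′) ∷ ρ ⊢ t ≈α t′ →
             ρ ⊢ letp x y s t ≈α letp x′ y′ s′ t′
    box    : ∀ {l d} {t t′ : Term l} → ρ ⊢ t ≈α t′ → ρ ⊢ box d t ≈α box d t′
    letbox : ∀ {l d x x′} {s t s′ t′ : Term l} → ρ ⊢ s ≈α s′ →
             (x , x′) ∷ ρ ⊢ t ≈α t′ →
             ρ ⊢ letbox d x s t ≈α letbox d x′ s′ t′
    delay  : ∀ {l d} {t t′ : Term l} → ρ ⊢ t ≈α t′ → ρ ⊢ delay d t ≈α delay d t′
    let′   : ∀ {l x x′} {s t s′ t′ : Term l} → ρ ⊢ s ≈α s′ →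
             (x , x′) ∷ ρ ⊢ t ≈α t′ →
             ρ ⊢ let′ x s t ≈α let′ x′ s′ t′
    _after_ : ∀ {t t′ : Term extended} {a b a′ b′} {c : Hom a b} {c′ : Hom a′ b′} →
              ρ ⊢ t ≈α t′ → c ≈ c′ → ρ ⊢ t after c ≈α t′ after c′

  _=α_ : ∀ {l} → Term l → Term l → Set
  t =α u = [] ⊢ t ≈α u

  infix 4 _⊢_∶_ _⊢*_∶_ _⊢ₙ_∶_ _⊢ₑ_∶_

  -- The rule `circ` types `t after c` only, so on annotated terms this is the
  -- typing judgement of the annotated language.
  mutual
    data _⊢_∶_ : ∀ {l} → Context → Term l → Type → Set where
      swap   : ∀ {l} Γ {x y Δ C} {t : Term l} →
               Γ ++ x ∷ y ∷ Δ ⊢ t ∶ C →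
               Γ ++ y ∷ x ∷ Δ ⊢ t ∶ C
      var    : ∀ {l x A} → [ x ∶⟨ 0# ⟩ A ] ⊢ var {l} x ∶ A
      𝟙-I    : ∀ {l} → [] ⊢ ⋆ {l} ∶ 𝟙
      𝟙-E    : ∀ {l Γ Δ A} {s t : Term l} d → Distinct (d +ᶜ Γ ++ Δ) →
               Γ ⊢ s ∶ 𝟙 → Δ ⊢ t ∶ A →
               d +ᶜ Γ ++ Δ ⊢ let⋆ s t ∶ A
      gate   : ∀ {l Γ G} {ts : List (Term l)} → Distinct (- duration G +ᶜ Γ) →
               Γ ⊢* ts ∶ qubits G →
               - duration G +ᶜ Γ ⊢ gate G ts ∶ ⨂ (qubits G)
      ⊗-I    : ∀ {l Γ Δ A B} {s t : Term l} → Distinct (Γ ++ Δ) →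
               Γ ⊢ s ∶ A → Δ ⊢ t ∶ B →
               Γ ++ Δ ⊢ pair s t ∶ A ⊗ B
      ⊗-E    : ∀ {l Γ Δ A B C x y d} {s t : Term l} → Distinct (d +ᶜ Γ ++ Δ) →
               Γ ⊢ s ∶ A ⊗ B → x ∶⟨ d ⟩ A ∷ y ∶⟨ d ⟩ B ∷ Δ ⊢ t ∶ C →
               d +ᶜ Γ ++ Δ ⊢ letp x y s t ∶ C
      □-I    : ∀ {l Γ A} {t : Term l} d →
               Γ ⊢ t ∶ A →
               d +ᶜ Γ ⊢ box d t ∶ □ d A
      □-E    : ∀ {l Γ Δ A B x d e} {s t : Term l} → Distinct ((e - d) +ᶜ Γ ++ Δ) →
               Γ ⊢ s ∶ □ d A → x ∶⟨ e ⟩ A ∷ Δ ⊢ t ∶ B →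
               (e - d) +ᶜ Γ ++ Δ ⊢ letbox d x s t ∶ B
      delay  : ∀ {l Γ q} {t : Term l} d → 0# ≤ d →
               Γ ⊢ t ∶ qubit q →
               - d +ᶜ Γ ⊢ delay d t ∶ qubit q
      let′   : ∀ {l Γ Δ A C x d} {s t : Term l} → Distinct (d +ᶜ Γ ++ Δ) →
               Γ ⊢ s ∶ A → x ∶⟨ d ⟩ A ∷ Δ ⊢ t ∶ C →
               d +ᶜ Γ ++ Δ ⊢ let′ x s t ∶ C
      circ   : ∀ {a b} (ns : Names a) (c : Hom a b) {t B} →
               qctx b (transport c ns) ⊢ t ∶ B →
               qctx a ns ⊢ t after c ∶ B

    -- The premises Γᵢ ⊢ tᵢ : qᵢ of the gate rule, with Γ = Γ₁, …, Γₙ.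
    data _⊢*_∶_ : ∀ {l} → Context → List (Term l) → List Qubit → Set where
      []  : ∀ {l} → [] ⊢* ([] {A = Term l}) ∶ []
      _∷_ : ∀ {l Γ Δ q qs} {t : Term l} {ts} →
            Γ ⊢ t ∶ qubit q → Δ ⊢* ts ∶ qs → Γ ++ Δ ⊢* t ∷ ts ∶ q ∷ qs

  data _⊢ₙ_∶_ : Context → Term extended → Type → Set where
    𝟙-I : [] ⊢ₙ ⋆ ∶ 𝟙
    var : ∀ {x q} → [ x ∶⟨ 0# ⟩ qubit q ] ⊢ₙ var x ∶ qubit q
    ⊗-I : ∀ {Γ Δ A B s t} → Distinct (Γ ++ Δ) →
          Γ ⊢ₙ s ∶ A → Δ ⊢ₙ t ∶ B →
          Γ ++ Δ ⊢ₙ pair s t ∶ A ⊗ B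
    □-I : ∀ {Γ A t} d →
          Γ ⊢ₙ t ∶ A →
          d +ᶜ Γ ⊢ₙ box d t ∶ □ d A

  data _⊢ₑ_∶_ : Context → Term extended → Type → Set where
    𝟙-E  : ∀ {a} (ns : Names a) {x d Δ A t} →
           Distinct (qctx a ns ++ x ∶⟨ d ⟩ 𝟙 ∷ Δ) →
           qctx a ns ++ Δ ⊢ₑ t ∶ A →
           qctx a ns ++ x ∶⟨ d ⟩ 𝟙 ∷ Δ ⊢ₑ let⋆ (var x) t ∶ A
    ⊗-E  : ∀ {a} (ns : Names a) {x y z d Δ A B C t} →
           Distinct (qctx a ns ++ z ∶⟨ d ⟩ (A ⊗ B) ∷ Δ) →
           qctx a ns ++ x ∶⟨ d ⟩ A ∷ y ∶⟨ d ⟩ B ∷ Δ ⊢ₑ t ∶ C →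
           qctx a ns ++ z ∶⟨ d ⟩ (A ⊗ B) ∷ Δ ⊢ₑ letp x y (var z) t ∶ C
    □-E  : ∀ {a} (ns : Names a) {x z d e Δ A B t} →
           Distinct (qctx a ns ++ z ∶⟨ d ⟩ □ e A ∷ Δ) →
           qctx a ns ++ x ∶⟨ d + e ⟩ A ∷ Δ ⊢ₑ t ∶ B →
           qctx a ns ++ z ∶⟨ d ⟩ □ e A ∷ Δ ⊢ₑ letbox e x (var z) t ∶ B
    circ : ∀ {a b} (ns : Names a) (c : Hom a b) {t B} →
           qctx b (transport c ns) ⊢ₙ t ∶ B →
           qctx a ns ⊢ₑ t after c ∶ B

  -- Normal forms as derivations of the extended language: an eliminator acts
  -- on a variable that Swap brings to the front of the context.

  to-front : ∀ {l} Γ Θ {x Δ A} {t : Term l} →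
             Γ ++ Θ ++ x ∷ Δ ⊢ t ∶ A → Γ ++ x ∷ Θ ++ Δ ⊢ t ∶ A
  to-front Γ [] D = D
  to-front Γ (y ∷ Θ) {x} {Δ} {A} {t} D =
    swap Γ (subst (_⊢ t ∶ A) (∷ʳ-++ Γ y (x ∷ Θ ++ Δ))
      (to-front (Γ ∷ʳ y) Θ (subst (_⊢ t ∶ A) (sym (∷ʳ-++ Γ y (Θ ++ x ∷ Δ))) D)))

  from-front : ∀ {l} Γ Θ {x Δ A} {t : Term l} →
               Γ ++ x ∷ Θ ++ Δ ⊢ t ∶ A → Γ ++ Θ ++ x ∷ Δ ⊢ t ∶ A
  from-front Γ [] D = D
  from-front Γ (y ∷ Θ) {x} {Δ} {A} {t} D =
    subst (_⊢ t ∶ A) (∷ʳ-++ Γ y (Θ ++ x ∷ Δ))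
      (from-front (Γ ∷ʳ y) Θ (subst (_⊢ t ∶ A) (sym (∷ʳ-++ Γ y (x ∷ Θ ++ Δ))) (swap Γ D)))

  distinct-to-front : ∀ Θ {x Δ} → Distinct (Θ ++ x ∷ Δ) → Distinct (x ∷ Θ ++ Δ)
  distinct-to-front Θ {x} {Δ} =
    PermSetoid.Unique-resp-↭ (setoid Name) (↭⇒↭ₛ (Perm.map⁺ name (Perm.shift x Θ Δ)))

  d+e-e≡d : ∀ d e → ((d + e) - e) + 0# ≡ d
  d+e-e≡d d e = trans (+-identityʳ _)
    (trans (+-assoc d e (- e)) (trans (cong (d +_) (-‿inverseʳ e)) (+-identityʳ d)))

  regrade : ∀ {l x d e A Γ B} {t : Term l} → d ≡ e →
            x ∶⟨ d ⟩ A ∷ Γ ⊢ t ∶ B → x ∶⟨ e ⟩ A ∷ Γ ⊢ t ∶ B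
  regrade refl D = D

  fromₙ : ∀ {Γ t A} → Γ ⊢ₙ t ∶ A → Γ ⊢ t ∶ A
  fromₙ 𝟙-I         = 𝟙-I
  fromₙ var         = var
  fromₙ (⊗-I p D E) = ⊗-I p (fromₙ D) (fromₙ E)
  fromₙ (□-I d D)   = □-I d (fromₙ D)

  fromₑ : ∀ {Γ t A} → Γ ⊢ₑ t ∶ A → Γ ⊢ t ∶ A
  fromₑ (𝟙-E {a} ns {x} {d} p D) =
    from-front [] Θ (regrade (+-identityʳ d)
      (𝟙-E {Γ = [ x ∶⟨ 0# ⟩ 𝟙 ]} d (distinct-to-front Θ p) var (fromₑ D)))
    where Θ = qctx a ns
  fromₑ (⊗-E {a} ns {x} {y} {z} {d} {Δ} {A} {B} p D) =
    from-front [] Θ (regrade (+-identityʳ d)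
      (⊗-E {Γ = [ z ∶⟨ 0# ⟩ (A ⊗ B) ]} (distinct-to-front Θ p) var
        (to-front [ x ∶⟨ d ⟩ A ] Θ (to-front [] Θ (fromₑ D)))))
    where Θ = qctx a ns
  fromₑ (□-E {a} ns {x} {z} {d} {e} {Δ} {A} p D) =
    from-front [] Θ (regrade (d+e-e≡d d e)
      (□-E {Γ = [ z ∶⟨ 0# ⟩ □ e A ]} (distinct-to-front Θ p) var
        (to-front [] Θ (fromₑ D))))
    where Θ = qctx a ns
  fromₑ (circ ns c D) = circ ns c (fromₙ D)

  ⟦_⟧ᵗ : Type → Obj
  ⟦ 𝟙 ⟧ᵗ       = []
  ⟦ qubit q ⟧ᵗ = [ (0# , q) ]
  ⟦ A ⊗ B ⟧ᵗ   = ⟦ A ⟧ᵗ ++ ⟦ B ⟧ᵗ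
  ⟦ □ d A ⟧ᵗ   = Shift d ⟦ A ⟧ᵗ

  ⟦_⟧ᶜ : Context → Obj
  ⟦ [] ⟧ᶜ             = []
  ⟦ x ∶⟨ d ⟩ A ∷ Γ ⟧ᶜ = Shift d ⟦ A ⟧ᵗ ++ ⟦ Γ ⟧ᶜ

  ⟦++⟧ : ∀ Γ Δ → ⟦ Γ ++ Δ ⟧ᶜ ≡ ⟦ Γ ⟧ᶜ ++ ⟦ Δ ⟧ᶜ
  ⟦++⟧ [] Δ = refl
  ⟦++⟧ (x ∶⟨ d ⟩ A ∷ Γ) Δ =
    trans (cong (Shift d ⟦ A ⟧ᵗ ++_) (⟦++⟧ Γ Δ)) (sym (++-assoc (Shift d ⟦ A ⟧ᵗ) ⟦ Γ ⟧ᶜ ⟦ Δ ⟧ᶜ))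

  ⟦+ᶜ⟧ : ∀ d Γ → ⟦ d +ᶜ Γ ⟧ᶜ ≡ Shift d ⟦ Γ ⟧ᶜ
  ⟦+ᶜ⟧ d [] = refl
  ⟦+ᶜ⟧ d (x ∶⟨ e ⟩ A ∷ Γ) =
    trans (cong₂ _++_ (sym (Shift-Shift d e ⟦ A ⟧ᵗ)) (⟦+ᶜ⟧ d Γ))
          (sym (Shift-++ d (Shift e ⟦ A ⟧ᵗ) ⟦ Γ ⟧ᶜ))

  ⟦+ᶜ++⟧ : ∀ d Γ Δ → ⟦ d +ᶜ Γ ++ Δ ⟧ᶜ ≡ Shift d ⟦ Γ ⟧ᶜ ++ ⟦ Δ ⟧ᶜ
  ⟦+ᶜ++⟧ d Γ Δ = trans (⟦++⟧ (d +ᶜ Γ) Δ) (cong (_++ ⟦ Δ ⟧ᶜ) (⟦+ᶜ⟧ d Γ))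

  ⟦⨂⟧ : ∀ qs → ⟦ ⨂ qs ⟧ᵗ ≡ at 0# qs
  ⟦⨂⟧ []           = refl
  ⟦⨂⟧ (q ∷ [])     = refl
  ⟦⨂⟧ (q ∷ r ∷ qs) = cong ((0# , q) ∷_) (⟦⨂⟧ (r ∷ qs))

  ⟦qctx⟧ : ∀ a (ns : Names a) → ⟦ qctx a ns ⟧ᶜ ≡ a
  ⟦qctx⟧ [] [] = refl
  ⟦qctx⟧ ((d , q) ∷ a) (n ∷ ns) = cong₂ (λ e b → (e , q) ∷ b) (+-identityʳ d) (⟦qctx⟧ a ns)

  ⟦swap⟧ : ∀ Γ x y Δ → Hom ⟦ Γ ++ y ∷ x ∷ Δ ⟧ᶜ ⟦ Γ ++ x ∷ y ∷ Δ ⟧ᶜ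
  ⟦swap⟧ Γ x y Δ = cast (endpoint y x) (endpoint x y)
                        (id {⟦ Γ ⟧ᶜ} ⊗₁ (σ (obj y) (obj x) ⊗₁ id {⟦ Δ ⟧ᶜ}))
    where
    obj : Declaration → Obj
    obj v = Shift (grade v) ⟦ type v ⟧ᵗ
    endpoint : ∀ v w → ⟦ Γ ⟧ᶜ ++ (obj v ++ obj w) ++ ⟦ Δ ⟧ᶜ ≡ ⟦ Γ ++ v ∷ w ∷ Δ ⟧ᶜ
    endpoint v w = trans (cong (⟦ Γ ⟧ᶜ ++_) (++-assoc (obj v) (obj w) ⟦ Δ ⟧ᶜ))
                         (sym (⟦++⟧ Γ (v ∷ w ∷ Δ)))

  e-d+d≡e : ∀ e d → (e - d) + d ≡ e
  e-d+d≡e e d = trans (+-assoc e (- d) d)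
    (trans (cong (e +_) (-‿inverseˡ d)) (+-identityʳ e))

  mutual
    ⟦_⟧ : ∀ {l Γ A} {t : Term l} → Γ ⊢ t ∶ A → Hom ⟦ Γ ⟧ᶜ ⟦ A ⟧ᵗ
    ⟦ swap Γ {x} {y} {Δ} D ⟧ = ⟦ D ⟧ ∘ ⟦swap⟧ Γ x y Δ
    ⟦ var {A = A} ⟧ =
      cast (sym (trans (++-identityʳ _) (Shift-0 ⟦ A ⟧ᵗ))) refl (id {⟦ A ⟧ᵗ})
    ⟦ 𝟙-I ⟧ = id
    ⟦ 𝟙-E {Γ = Γ} {Δ} d _ D E ⟧ =
      cast (sym (⟦+ᶜ++⟧ d Γ Δ)) refl (Shift₁ d ⟦ D ⟧ ⊗₁ ⟦ E ⟧)
    ⟦ gate {Γ = Γ} {G} _ Ds ⟧ =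
      cast (sym (⟦+ᶜ⟧ (- d) Γ))
           (trans (cong (λ x → at x qs) (-‿inverseˡ d)) (sym (⟦⨂⟧ qs)))
           (φ G (- d) ∘
            cast refl (trans (Shift-at (- d) 0# qs) (cong (λ x → at x qs) (+-identityʳ (- d))))
                 (Shift₁ (- d) ⟦ Ds ⟧*))
      where
      d  = duration G
      qs = qubits G
    ⟦ ⊗-I {Γ = Γ} {Δ} _ D E ⟧ =
      cast (sym (⟦++⟧ Γ Δ)) refl (⟦ D ⟧ ⊗₁ ⟦ E ⟧)
    ⟦ ⊗-E {Γ = Γ} {Δ} {A} {B} {d = d} _ D E ⟧ =
      ⟦ E ⟧ ∘ cast (sym (⟦+ᶜ++⟧ d Γ Δ))
                   (trans (cong (_++ ⟦ Δ ⟧ᶜ) (Shift-++ d ⟦ A ⟧ᵗ ⟦ B ⟧ᵗ))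
                          (++-assoc (Shift d ⟦ A ⟧ᵗ) (Shift d ⟦ B ⟧ᵗ) ⟦ Δ ⟧ᶜ))
                   (Shift₁ d ⟦ D ⟧ ⊗₁ id {⟦ Δ ⟧ᶜ})
    ⟦ □-I {Γ = Γ} d D ⟧ =
      cast (sym (⟦+ᶜ⟧ d Γ)) refl (Shift₁ d ⟦ D ⟧)
    ⟦ □-E {Γ = Γ} {Δ} {A} {d = d} {e} _ D E ⟧ =
      ⟦ E ⟧ ∘ cast (sym (⟦+ᶜ++⟧ (e - d) Γ Δ))
                   (cong (_++ ⟦ Δ ⟧ᶜ) (trans (Shift-Shift (e - d) d ⟦ A ⟧ᵗ)
                                             (cong (λ x → Shift x ⟦ A ⟧ᵗ) (e-d+d≡e e d))))
                   (Shift₁ (e - d) ⟦ D ⟧ ⊗₁ id {⟦ Δ ⟧ᶜ})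
    ⟦ delay {Γ = Γ} {q} d d≥0 D ⟧ =
      cast (sym (⟦+ᶜ⟧ (- d) Γ)) (cong (λ x → [ (x , q) ]) (-‿inverseˡ d))
           (delay d d≥0 (- d) q ∘
            cast refl (cong (λ x → [ (x , q) ]) (+-identityʳ (- d))) (Shift₁ (- d) ⟦ D ⟧))
    ⟦ let′ {Γ = Γ} {Δ} {d = d} _ D E ⟧ =
      ⟦ E ⟧ ∘ cast (sym (⟦+ᶜ++⟧ d Γ Δ)) refl (Shift₁ d ⟦ D ⟧ ⊗₁ id {⟦ Δ ⟧ᶜ})
    ⟦ circ {a} {b} ns c D ⟧ =
      ⟦ D ⟧ ∘ cast (sym (⟦qctx⟧ a ns)) (sym (⟦qctx⟧ b (transport c ns))) c

    ⟦_⟧* : ∀ {l Γ qs} {ts : List (Term l)} → Γ ⊢* ts ∶ qs → Hom ⟦ Γ ⟧ᶜ (at 0# qs)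
    ⟦ [] ⟧* = id
    ⟦ _∷_ {Γ = Γ} {Δ} D Ds ⟧* = cast (sym (⟦++⟧ Γ Δ)) refl (⟦ D ⟧ ⊗₁ ⟦ Ds ⟧*)

  ⟦_⟧ₑ : ∀ {Γ t A} → Γ ⊢ₑ t ∶ A → Hom ⟦ Γ ⟧ᶜ ⟦ A ⟧ᵗ
  ⟦ D ⟧ₑ = ⟦ fromₑ D ⟧

{-# OPTIONS --safe #-}
-- A normal form of Γ ⊢ A carries no more information than a morphism
-- ⟦ Γ ⟧ → ⟦ A ⟧ of Circ, so only the distinctness of the names in Γ is needed
-- from the derivation of t.  Indeed the three eliminators of a variable do not
-- change the interpretation: the symmetries that bring the variable to the
-- front and its components back cancel.  Which eliminator comes next is
-- dictated by the first non-qubit type of the context, and once only qubits are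
-- left, the term t of `t after c` is interpreted as an identity, so that c is
-- the given morphism and the variables of t, read from left to right, are the
-- names of the context permuted by c.  The permutation is invariant under _≈_,
-- hence equal interpretations give α-equivalent normal forms.
module Submission where

open import Defs
open import Data.List using (List; []; _∷_; [_]; _++_; _∷ʳ_; map; length; take; drop)
open import Data.List.Extrema.Nat using (max; xs≤max)
open import Data.List.Properties
  using (++-assoc; ++-identityʳ; ∷ʳ-++; length-++; length-map; map-∘; take++drop≡id)
open import Data.List.Relation.Binary.Permutation.Propositional
  using (_↭_; ↭-refl; ↭-sym; ↭-trans; ↭-reflexive; ↭⇒↭ₛ)
import Data.List.Relation.Binary.Permutation.Propositional.Properties as Perm
import Data.List.Relation.Binary.Permutation.Setoid.Properties as PermSetoid
open import Data.List.Relation.Binary.Pointwise as Pointwise using (Pointwise; []; _∷_)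
open import Data.List.Relation.Unary.All as All using (All; []; _∷_; reduce)
open import Data.List.Relation.Unary.All.Properties using (++⁺; ++⁻; ++⁻ˡ; ++⁻ʳ; map⁺; map⁻)
open import Data.List.Relation.Unary.AllPairs using ([]; _∷_)
import Data.List.Relation.Unary.AllPairs.Properties as AllPairs
open import Data.List.Relation.Unary.Unique.Propositional using (Unique)
open import Data.Maybe using (Maybe; just; nothing)
open import Data.Nat using (zero; suc; s≤s)
open import Data.Nat.Properties using (+-comm; suc-injective; <⇒≢)
open import Data.Product using (Σ-syntax; ∃!; ∃-syntax; _×_; _,_; proj₁; proj₂)
open import Relation.Binary.PropositionalEquality
  using (_≡_; _≢_; refl; sym; trans; cong; cong₂; subst; setoid)

module Circuits (ℛ : RealNumbers) (𝒮 : GateSet ℛ) where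
  open Language ℛ 𝒮

  -- Morphisms and their composites

  infixr 2 _≈⟨_⟩_ _≈⟨_⟨_
  infix  3 _∎

  _≈⟨_⟩_ : ∀ {a b a′ b′ a″ b″} (f : Hom a b) {g : Hom a′ b′} {h : Hom a″ b″} →
           f ≈ g → g ≈ h → f ≈ h
  f ≈⟨ p ⟩ q = ≈-trans p q

  _≈⟨_⟨_ : ∀ {a b a′ b′ a″ b″} (f : Hom a b) {g : Hom a′ b′} {h : Hom a″ b″} →
           g ≈ f → g ≈ h → f ≈ h
  f ≈⟨ p ⟨ q = ≈-trans (≈-sym p) q

  _∎ : ∀ {a b} (f : Hom a b) → f ≈ f
  f ∎ = ≈-refl

  ≈-endpoints : ∀ {a b a′ b′} {f : Hom a b} {g : Hom a′ b′} → f ≈ g → a ≡ a′ × b ≡ b′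
  ≈-endpoints ≈-refl = refl , refl
  ≈-endpoints (≈-sym p) with refl , refl ← ≈-endpoints p = refl , refl
  ≈-endpoints (≈-trans p q)
    with refl , refl ← ≈-endpoints p | refl , refl ← ≈-endpoints q = refl , refl
  ≈-endpoints (∘-cong p q) = proj₁ (≈-endpoints q) , proj₂ (≈-endpoints p)
  ≈-endpoints (⊗-cong p q) =
    cong₂ _++_ (proj₁ (≈-endpoints p)) (proj₁ (≈-endpoints q)) ,
    cong₂ _++_ (proj₂ (≈-endpoints p)) (proj₂ (≈-endpoints q))
  ≈-endpoints identityˡ = refl , refl
  ≈-endpoints identityʳ = refl , refl
  ≈-endpoints assoc = refl , refl
  ≈-endpoints ⊗-id = refl , refl
  ≈-endpoints ⊗-∘ = refl , refl
  ≈-endpoints ⊗-identityˡ = refl , refl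
  ≈-endpoints ⊗-identityʳ = ++-identityʳ _ , ++-identityʳ _
  ≈-endpoints (⊗-assoc {a} {b} {c} {d} {a′} {b′}) = ++-assoc a c a′ , ++-assoc b d b′
  ≈-endpoints σ-natural = refl , refl
  ≈-endpoints σ-involutive = refl , refl
  ≈-endpoints (σ-hexagon {a} {b} {c} p q) =
    trans (sym (++-assoc a b c)) (sym (proj₁ (≈-endpoints p))) ,
    trans (++-assoc b c a) (sym (proj₂ (≈-endpoints q)))

  cast-≈ : ∀ {a a′ b b′} (p : a ≡ a′) (q : b ≡ b′) {f : Hom a b} → cast p q f ≈ f
  cast-≈ refl refl = ≈-refl

  id-cong : ∀ {a b} → a ≡ b → id {a} ≈ id {b}
  id-cong refl = ≈-refl

  σ-cong : ∀ {a b a′ b′} → a ≡ a′ → b ≡ b′ → σ a b ≈ σ a′ b′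
  σ-cong refl refl = ≈-refl

  ∘-elimʳ : ∀ {a b c d} {g : Hom b c} {f : Hom a b} → f ≈ id {d} → g ∘ f ≈ g
  ∘-elimʳ p with refl , refl ← ≈-endpoints p = ≈-trans (∘-cong ≈-refl p) identityʳ

  ∘-elimˡ : ∀ {a b c d} {g : Hom b c} {f : Hom a b} → g ≈ id {d} → g ∘ f ≈ f
  ∘-elimˡ p with refl , refl ← ≈-endpoints p = ≈-trans (∘-cong p ≈-refl) identityˡ

  ∘-cancel : ∀ {a b c d} {g : Hom b c} {f : Hom a b} {h : Hom c d} {e} →
             h ∘ g ≈ id {e} → h ∘ (g ∘ f) ≈ f
  ∘-cancel p = ≈-trans (≈-sym assoc) (∘-elimˡ p)

  ⊗-id-∘ : ∀ {a b c d} {g : Hom b c} {f : Hom a b} →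
           (g ∘ f) ⊗₁ id {d} ≈ (g ⊗₁ id {d}) ∘ (f ⊗₁ id)
  ⊗-id-∘ = ≈-trans (⊗-cong ≈-refl (≈-sym identityˡ)) ⊗-∘

  id-⊗-∘ : ∀ {a b c d} {g : Hom b c} {f : Hom a b} →
           id {d} ⊗₁ (g ∘ f) ≈ (id {d} ⊗₁ g) ∘ (id ⊗₁ f)
  id-⊗-∘ = ≈-trans (⊗-cong (≈-sym identityˡ) ≈-refl) ⊗-∘

  -- σ a [] is idempotent by the hexagon axiom and invertible.
  σ-[]ʳ : ∀ a → σ a [] ≈ id {a}
  σ-[]ʳ a =
    σ a []                ≈⟨ s≈σ ⟨
    s                     ≈⟨ ∘-cancel σ-involutive ⟨
    σ [] a ∘ (σ a [] ∘ s) ≈⟨ ∘-cong ≈-refl idem ⟨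
    σ [] a ∘ σ a []       ≈⟨ σ-involutive ⟩
    id                    ≈⟨ id-cong (++-identityʳ a) ⟩
    id                    ∎
    where
    s : Hom (a ++ []) (a ++ [])
    s = cast refl (sym (++-identityʳ a)) (σ a [])
    s≈σ : s ≈ σ a []
    s≈σ = cast-≈ refl (sym (++-identityʳ a))
    idem : σ a [] ≈ σ a [] ∘ s
    idem = σ-hexagon {a} {[]} {[]} (≈-trans s≈σ (≈-sym ⊗-identityʳ)) (≈-sym ⊗-identityˡ)

  σ-[]ˡ : ∀ a → σ [] a ≈ id {a}
  σ-[]ˡ a =
    σ [] a          ≈⟨ ∘-elimʳ (σ-[]ʳ a) ⟨
    σ [] a ∘ σ a [] ≈⟨ σ-involutive ⟩
    id              ≈⟨ id-cong (++-identityʳ a) ⟩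
    id              ∎

  -- The inverse of the hexagon axiom.
  σ-hexagonʳ : ∀ {a b c x y z} {f : Hom x y} {g : Hom y z} →
               f ≈ id {a} ⊗₁ σ b c → g ≈ σ a c ⊗₁ id {b} → σ (a ++ b) c ≈ g ∘ f
  σ-hexagonʳ {a} {b} {c} {x} {y} {z} {f} {g} p q =
    σ (a ++ b) c      ≈⟨ cast-≈ x≡ z≡ ⟨
    s                 ≈⟨ ∘-elimʳ k∘h ⟨
    s ∘ (k ∘ (g ∘ f)) ≈⟨ ∘-cancel s∘k ⟩
    g ∘ f             ∎
    where
    x≡ = trans (++-assoc a b c) (sym (proj₁ (≈-endpoints p)))
    y≡ = sym (proj₂ (≈-endpoints p))
    z≡ = trans (sym (++-assoc c a b)) (sym (proj₂ (≈-endpoints q)))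
    s : Hom x z
    s = cast x≡ z≡ (σ (a ++ b) c)
    f⁻¹ : Hom y x
    f⁻¹ = cast y≡ (sym (proj₁ (≈-endpoints p))) (id {a} ⊗₁ σ c b)
    g⁻¹ : Hom z y
    g⁻¹ = cast (sym (proj₂ (≈-endpoints q))) (sym (proj₁ (≈-endpoints q))) (σ c a ⊗₁ id {b})
    k : Hom z x
    k = f⁻¹ ∘ g⁻¹
    f⁻¹∘f : f⁻¹ ∘ f ≈ id
    f⁻¹∘f =
      f⁻¹ ∘ f                             ≈⟨ ∘-cong (cast-≈ y≡ _) p ⟩
      (id {a} ⊗₁ σ c b) ∘ (id {a} ⊗₁ σ b c)   ≈⟨ id-⊗-∘ ⟨
      id {a} ⊗₁ (σ c b ∘ σ b c)           ≈⟨ ⊗-cong ≈-refl σ-involutive ⟩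
      id {a} ⊗₁ id                        ≈⟨ ⊗-id ⟩
      id                                  ∎
    g⁻¹∘g : g⁻¹ ∘ g ≈ id
    g⁻¹∘g =
      g⁻¹ ∘ g                             ≈⟨ ∘-cong (cast-≈ _ _) q ⟩
      (σ c a ⊗₁ id {b}) ∘ (σ a c ⊗₁ id)   ≈⟨ ⊗-id-∘ ⟨
      (σ c a ∘ σ a c) ⊗₁ id {b}           ≈⟨ ⊗-cong σ-involutive ≈-refl ⟩
      id ⊗₁ id {b}                        ≈⟨ ⊗-id ⟩
      id                                  ∎
    k∘h : k ∘ (g ∘ f) ≈ id
    k∘h =
      (f⁻¹ ∘ g⁻¹) ∘ (g ∘ f)   ≈⟨ assoc ⟩
      f⁻¹ ∘ (g⁻¹ ∘ (g ∘ f))   ≈⟨ ∘-cong ≈-refl (∘-cancel g⁻¹∘g) ⟩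
      f⁻¹ ∘ f                 ≈⟨ f⁻¹∘f ⟩
      id                      ∎
    s∘k : s ∘ k ≈ id
    s∘k =
      s ∘ k                           ≈⟨ ∘-cong (≈-sym (cast-≈ x≡ z≡)) (σ-hexagon (cast-≈ _ _) (cast-≈ y≡ _)) ⟨
      σ (a ++ b) c ∘ σ c (a ++ b)     ≈⟨ σ-involutive ⟩
      id                              ∎

  whisker : ∀ a {b c} → Hom b c → ∀ d → Hom (a ++ (b ++ d)) (a ++ (c ++ d))
  whisker a f d = id {a} ⊗₁ (f ⊗₁ id {d})

  whisker-cong : ∀ {a b c d a′ b′ c′ d′} {f : Hom b c} {g : Hom b′ c′} →
                 a ≡ a′ → f ≈ g → d ≡ d′ → whisker a f d ≈ whisker a′ g d′
  whisker-cong p q r = ⊗-cong (id-cong p) (⊗-cong q (id-cong r))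

  whisker-∘ : ∀ {a b c d e} {g : Hom c d} {f : Hom b c} →
              whisker a (g ∘ f) e ≈ whisker a g e ∘ whisker a f e
  whisker-∘ = ≈-trans (⊗-cong ≈-refl ⊗-id-∘) id-⊗-∘

  whisker-id : ∀ {a b d} → whisker a (id {b}) d ≈ id {a ++ (b ++ d)}
  whisker-id = ≈-trans (⊗-cong ≈-refl ⊗-id) ⊗-id

  whisker-⊗-id : ∀ {a b c d e} {f : Hom b c} → whisker a (f ⊗₁ id {d}) e ≈ whisker a f (d ++ e)
  whisker-⊗-id = ⊗-cong ≈-refl (≈-trans ⊗-assoc (⊗-cong ≈-refl ⊗-id))

  whisker-id-⊗ : ∀ {a b c d e} {f : Hom b c} → whisker a (id {d} ⊗₁ f) e ≈ whisker (a ++ d) f e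
  whisker-id-⊗ =
    ≈-trans (⊗-cong ≈-refl ⊗-assoc) (≈-trans (≈-sym ⊗-assoc) (⊗-cong ⊗-id ≈-refl))

  data IsIdentity : ∀ {a b} → Hom a b → Set where
    id  : ∀ {a} → IsIdentity (id {a})
    _⊗_ : ∀ {a b c d} {f : Hom a b} {g : Hom c d} →
          IsIdentity f → IsIdentity g → IsIdentity (f ⊗₁ g)

  identity-≈ : ∀ {a b} {f : Hom a b} → IsIdentity f → f ≈ id {a}
  identity-≈ id      = ≈-refl
  identity-≈ (p ⊗ q) = ≈-trans (⊗-cong (identity-≈ p) (identity-≈ q)) ⊗-id

  identity-cast : ∀ {a a′ b b′} (p : a ≡ a′) (q : b ≡ b′) {f : Hom a b} →
                  IsIdentity f → IsIdentity (cast p q f)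
  identity-cast refl refl i = i

  identity-Shift₁ : ∀ {a b} d {f : Hom a b} → IsIdentity f → IsIdentity (Shift₁ d f)
  identity-Shift₁ d id = id
  identity-Shift₁ d (_⊗_ {a} {b} {a′} {b′} p q) =
    identity-cast (sym (Shift-++ d a a′)) (sym (Shift-++ d b b′))
      (identity-Shift₁ d p ⊗ identity-Shift₁ d q)

  -- Interpretation of the eliminators of variables

  ⟦subst⟧ : ∀ {l Γ Γ′ A} {t : Term l} (p : Γ ≡ Γ′) (D : Γ ⊢ t ∶ A) →
            ⟦ subst (_⊢ t ∶ A) p D ⟧ ≈ ⟦ D ⟧
  ⟦subst⟧ refl D = ≈-refl

  ⟦regrade⟧ : ∀ {l x d e A Γ B} {t : Term l} (p : d ≡ e) (D : x ∶⟨ d ⟩ A ∷ Γ ⊢ t ∶ B) →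
              ⟦ regrade p D ⟧ ≈ ⟦ D ⟧
  ⟦regrade⟧ refl D = ≈-refl

  ⟦_⟧ᵈ : Declaration → Obj
  ⟦ v ⟧ᵈ = Shift (grade v) ⟦ type v ⟧ᵗ

  ⟦∷ʳ⟧ : ∀ Γ x → ⟦ Γ ∷ʳ x ⟧ᶜ ≡ ⟦ Γ ⟧ᶜ ++ ⟦ x ⟧ᵈ
  ⟦∷ʳ⟧ Γ x = trans (⟦++⟧ Γ [ x ]) (cong (⟦ Γ ⟧ᶜ ++_) (++-identityʳ ⟦ x ⟧ᵈ))

  ⟦swap⟧-≈ : ∀ Γ x y Δ → ⟦swap⟧ Γ x y Δ ≈ whisker ⟦ Γ ⟧ᶜ (σ ⟦ y ⟧ᵈ ⟦ x ⟧ᵈ) ⟦ Δ ⟧ᶜ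
  ⟦swap⟧-≈ Γ x y Δ = cast-≈ _ _

  ⟦++3⟧ : ∀ Γ Θ x Δ → ⟦ Γ ⟧ᶜ ++ ((⟦ Θ ⟧ᶜ ++ ⟦ x ⟧ᵈ) ++ ⟦ Δ ⟧ᶜ) ≡ ⟦ Γ ++ Θ ++ x ∷ Δ ⟧ᶜ
  ⟦++3⟧ Γ Θ x Δ = trans (cong (⟦ Γ ⟧ᶜ ++_)
      (trans (++-assoc ⟦ Θ ⟧ᶜ ⟦ x ⟧ᵈ ⟦ Δ ⟧ᶜ) (sym (⟦++⟧ Θ (x ∷ Δ)))))
    (sym (⟦++⟧ Γ (Θ ++ x ∷ Δ)))

  ⟦++3⟧′ : ∀ Γ x Θ Δ → ⟦ Γ ⟧ᶜ ++ ((⟦ x ⟧ᵈ ++ ⟦ Θ ⟧ᶜ) ++ ⟦ Δ ⟧ᶜ) ≡ ⟦ Γ ++ x ∷ Θ ++ Δ ⟧ᶜ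
  ⟦++3⟧′ Γ x Θ Δ = trans (cong (⟦ Γ ⟧ᶜ ++_)
      (trans (++-assoc ⟦ x ⟧ᵈ ⟦ Θ ⟧ᶜ ⟦ Δ ⟧ᶜ) (cong (⟦ x ⟧ᵈ ++_) (sym (⟦++⟧ Θ Δ)))))
    (sym (⟦++⟧ Γ (x ∷ Θ ++ Δ)))

  ⟦from-front⟧ : ∀ {l} Γ Θ {x Δ A} {t : Term l} (D : Γ ++ x ∷ Θ ++ Δ ⊢ t ∶ A)
                 {f : Hom ⟦ Γ ++ Θ ++ x ∷ Δ ⟧ᶜ ⟦ Γ ++ x ∷ Θ ++ Δ ⟧ᶜ} →
                 f ≈ whisker ⟦ Γ ⟧ᶜ (σ ⟦ Θ ⟧ᶜ ⟦ x ⟧ᵈ) ⟦ Δ ⟧ᶜ →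
                 ⟦ from-front Γ Θ D ⟧ ≈ ⟦ D ⟧ ∘ f
  ⟦from-front⟧ Γ [] {x} D p =
    ≈-sym (∘-elimʳ (≈-trans p (≈-trans (whisker-cong refl (σ-[]ˡ ⟦ x ⟧ᵈ) refl) whisker-id)))
  ⟦from-front⟧ Γ (y ∷ Θ) {x} {Δ} {A} {t} D {f} p =
    ⟦ from-front Γ (y ∷ Θ) D ⟧      ≈⟨ ⟦subst⟧ (∷ʳ-++ Γ y (Θ ++ x ∷ Δ)) _ ⟩
    ⟦ from-front (Γ ∷ʳ y) Θ D′ ⟧    ≈⟨ ⟦from-front⟧ (Γ ∷ʳ y) Θ D′ {f₁} f₁≈ ⟩
    ⟦ D′ ⟧ ∘ f₁                     ≈⟨ ∘-cong (⟦subst⟧ (sym (∷ʳ-++ Γ y (x ∷ Θ ++ Δ))) (swap Γ D)) (≈-sym (cast-≈ r q)) ⟩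
    ⟦ swap Γ D ⟧ ∘ f₂               ≈⟨ assoc ⟩
    ⟦ D ⟧ ∘ (s ∘ f₂)                ≈⟨ ∘-cong ≈-refl (≈-trans eq (≈-sym p)) ⟩
    ⟦ D ⟧ ∘ f                       ∎
    where
    D′ = subst (_⊢ t ∶ A) (sym (∷ʳ-++ Γ y (x ∷ Θ ++ Δ))) (swap Γ D)
    f₁ = cast (⟦++3⟧ (Γ ∷ʳ y) Θ x Δ) (⟦++3⟧′ (Γ ∷ʳ y) x Θ Δ)
              (whisker ⟦ Γ ∷ʳ y ⟧ᶜ (σ ⟦ Θ ⟧ᶜ ⟦ x ⟧ᵈ) ⟦ Δ ⟧ᶜ)
    f₁≈ = cast-≈ (⟦++3⟧ (Γ ∷ʳ y) Θ x Δ) (⟦++3⟧′ (Γ ∷ʳ y) x Θ Δ)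
    q = cong ⟦_⟧ᶜ (∷ʳ-++ Γ y (x ∷ Θ ++ Δ))
    r = cong ⟦_⟧ᶜ (∷ʳ-++ Γ y (Θ ++ x ∷ Δ))
    f₂ = cast r q f₁
    s = ⟦swap⟧ Γ x y (Θ ++ Δ)
    f₃ = id {⟦ y ⟧ᵈ} ⊗₁ σ ⟦ Θ ⟧ᶜ ⟦ x ⟧ᵈ
    a₃ = sym (++-assoc ⟦ y ⟧ᵈ ⟦ x ⟧ᵈ ⟦ Θ ⟧ᶜ)
    s₃ = σ ⟦ y ⟧ᵈ ⟦ x ⟧ᵈ ⊗₁ id {⟦ Θ ⟧ᶜ}
    eq : s ∘ f₂ ≈ whisker ⟦ Γ ⟧ᶜ (σ (⟦ y ⟧ᵈ ++ ⟦ Θ ⟧ᶜ) ⟦ x ⟧ᵈ) ⟦ Δ ⟧ᶜ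
    eq = ≈-sym (
      whisker ⟦ Γ ⟧ᶜ (σ (⟦ y ⟧ᵈ ++ ⟦ Θ ⟧ᶜ) ⟦ x ⟧ᵈ) ⟦ Δ ⟧ᶜ
        ≈⟨ whisker-cong refl (σ-hexagonʳ (cast-≈ refl a₃ {f₃}) ≈-refl) refl ⟩
      whisker ⟦ Γ ⟧ᶜ (s₃ ∘ cast refl a₃ f₃) ⟦ Δ ⟧ᶜ
        ≈⟨ whisker-∘ ⟩
      whisker ⟦ Γ ⟧ᶜ s₃ ⟦ Δ ⟧ᶜ ∘ whisker ⟦ Γ ⟧ᶜ (cast refl a₃ f₃) ⟦ Δ ⟧ᶜ
        ≈⟨ ∘-cong
             (≈-trans whisker-⊗-id (≈-trans (whisker-cong refl ≈-refl (sym (⟦++⟧ Θ Δ)))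
               (≈-sym (⟦swap⟧-≈ Γ x y (Θ ++ Δ)))))
             (≈-trans (whisker-cong refl (cast-≈ refl a₃) refl)
               (≈-trans whisker-id-⊗ (≈-trans (whisker-cong (sym (⟦∷ʳ⟧ Γ y)) ≈-refl refl)
                 (≈-trans (≈-sym f₁≈) (≈-sym (cast-≈ r q)))))) ⟩
      s ∘ f₂ ∎)

  ⟦to-front⟧ : ∀ {l} Γ Θ {x Δ A} {t : Term l} (D : Γ ++ Θ ++ x ∷ Δ ⊢ t ∶ A)
               {f : Hom ⟦ Γ ++ x ∷ Θ ++ Δ ⟧ᶜ ⟦ Γ ++ Θ ++ x ∷ Δ ⟧ᶜ} →
               f ≈ whisker ⟦ Γ ⟧ᶜ (σ ⟦ x ⟧ᵈ ⟦ Θ ⟧ᶜ) ⟦ Δ ⟧ᶜ →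
               ⟦ to-front Γ Θ D ⟧ ≈ ⟦ D ⟧ ∘ f
  ⟦to-front⟧ Γ [] {x} D p =
    ≈-sym (∘-elimʳ (≈-trans p (≈-trans (whisker-cong refl (σ-[]ʳ ⟦ x ⟧ᵈ) refl)
      whisker-id)))
  ⟦to-front⟧ Γ (y ∷ Θ) {x} {Δ} {A} {t} D {f} p =
    ⟦ to-front Γ (y ∷ Θ) D ⟧        ≈⟨ ∘-cong (⟦subst⟧ (∷ʳ-++ Γ y (x ∷ Θ ++ Δ)) _) (≈-sym s′≈) ⟩
    ⟦ to-front (Γ ∷ʳ y) Θ D′ ⟧ ∘ s′ ≈⟨ ∘-cong (⟦to-front⟧ (Γ ∷ʳ y) Θ D′ {f₁} f₁≈) ≈-refl ⟩
    (⟦ D′ ⟧ ∘ f₁) ∘ s′              ≈⟨ ∘-cong (∘-cong (⟦subst⟧ (sym (∷ʳ-++ Γ y (Θ ++ x ∷ Δ))) D) (≈-sym (cast-≈ q r))) s′≈ ⟩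
    (⟦ D ⟧ ∘ f₂) ∘ s                ≈⟨ assoc ⟩
    ⟦ D ⟧ ∘ (f₂ ∘ s)                ≈⟨ ∘-cong ≈-refl (≈-trans eq (≈-sym p)) ⟩
    ⟦ D ⟧ ∘ f                       ∎
    where
    D′ = subst (_⊢ t ∶ A) (sym (∷ʳ-++ Γ y (Θ ++ x ∷ Δ))) D
    f₁ = cast (⟦++3⟧′ (Γ ∷ʳ y) x Θ Δ) (⟦++3⟧ (Γ ∷ʳ y) Θ x Δ)
              (whisker ⟦ Γ ∷ʳ y ⟧ᶜ (σ ⟦ x ⟧ᵈ ⟦ Θ ⟧ᶜ) ⟦ Δ ⟧ᶜ)
    f₁≈ = cast-≈ (⟦++3⟧′ (Γ ∷ʳ y) x Θ Δ) (⟦++3⟧ (Γ ∷ʳ y) Θ x Δ)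
    q = cong ⟦_⟧ᶜ (∷ʳ-++ Γ y (x ∷ Θ ++ Δ))
    r = cong ⟦_⟧ᶜ (∷ʳ-++ Γ y (Θ ++ x ∷ Δ))
    f₂ = cast q r f₁
    s = ⟦swap⟧ Γ y x (Θ ++ Δ)
    s′ = cast refl (cong ⟦_⟧ᶜ (sym (∷ʳ-++ Γ y (x ∷ Θ ++ Δ)))) s
    s′≈ = cast-≈ refl (cong ⟦_⟧ᶜ (sym (∷ʳ-++ Γ y (x ∷ Θ ++ Δ)))) {s}
    f₃ = id {⟦ y ⟧ᵈ} ⊗₁ σ ⟦ x ⟧ᵈ ⟦ Θ ⟧ᶜ
    a₃ = sym (++-assoc ⟦ y ⟧ᵈ ⟦ x ⟧ᵈ ⟦ Θ ⟧ᶜ)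
    s₃ = σ ⟦ x ⟧ᵈ ⟦ y ⟧ᵈ ⊗₁ id {⟦ Θ ⟧ᶜ}
    eq : f₂ ∘ s ≈ whisker ⟦ Γ ⟧ᶜ (σ ⟦ x ⟧ᵈ (⟦ y ⟧ᵈ ++ ⟦ Θ ⟧ᶜ)) ⟦ Δ ⟧ᶜ
    eq = ≈-sym (
      whisker ⟦ Γ ⟧ᶜ (σ ⟦ x ⟧ᵈ (⟦ y ⟧ᵈ ++ ⟦ Θ ⟧ᶜ)) ⟦ Δ ⟧ᶜ
        ≈⟨ whisker-cong refl (σ-hexagon ≈-refl (cast-≈ a₃ refl {f₃})) refl ⟩
      whisker ⟦ Γ ⟧ᶜ (cast a₃ refl f₃ ∘ s₃) ⟦ Δ ⟧ᶜ
        ≈⟨ whisker-∘ ⟩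
      whisker ⟦ Γ ⟧ᶜ (cast a₃ refl f₃) ⟦ Δ ⟧ᶜ ∘ whisker ⟦ Γ ⟧ᶜ s₃ ⟦ Δ ⟧ᶜ
        ≈⟨ ∘-cong
             (≈-trans (whisker-cong refl (cast-≈ a₃ refl) refl)
               (≈-trans whisker-id-⊗ (≈-trans (whisker-cong (sym (⟦∷ʳ⟧ Γ y)) ≈-refl refl)
                 (≈-trans (≈-sym f₁≈) (≈-sym (cast-≈ q r))))))
             (≈-trans whisker-⊗-id (≈-trans (whisker-cong refl ≈-refl (sym (⟦++⟧ Θ Δ)))
               (≈-sym (⟦swap⟧-≈ Γ y x (Θ ++ Δ))))) ⟩
      f₂ ∘ s ∎)

  moveʳ : ∀ Γ x Θ Δ → Hom ⟦ Γ ++ x ∷ Θ ++ Δ ⟧ᶜ ⟦ Γ ++ Θ ++ x ∷ Δ ⟧ᶜ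
  moveʳ Γ x Θ Δ = cast (⟦++3⟧′ Γ x Θ Δ) (⟦++3⟧ Γ Θ x Δ)
                       (whisker ⟦ Γ ⟧ᶜ (σ ⟦ x ⟧ᵈ ⟦ Θ ⟧ᶜ) ⟦ Δ ⟧ᶜ)

  moveʳ-≈ : ∀ Γ x Θ Δ → moveʳ Γ x Θ Δ ≈ whisker ⟦ Γ ⟧ᶜ (σ ⟦ x ⟧ᵈ ⟦ Θ ⟧ᶜ) ⟦ Δ ⟧ᶜ
  moveʳ-≈ Γ x Θ Δ = cast-≈ (⟦++3⟧′ Γ x Θ Δ) (⟦++3⟧ Γ Θ x Δ)

  moveˡ : ∀ Θ x Δ → Hom ⟦ Θ ++ x ∷ Δ ⟧ᶜ ⟦ x ∷ Θ ++ Δ ⟧ᶜ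
  moveˡ Θ x Δ = cast (⟦++3⟧ [] Θ x Δ) (⟦++3⟧′ [] x Θ Δ)
                     (whisker [] (σ ⟦ Θ ⟧ᶜ ⟦ x ⟧ᵈ) ⟦ Δ ⟧ᶜ)

  moveˡ-≈ : ∀ Θ x Δ → moveˡ Θ x Δ ≈ whisker [] (σ ⟦ Θ ⟧ᶜ ⟦ x ⟧ᵈ) ⟦ Δ ⟧ᶜ
  moveˡ-≈ Θ x Δ = cast-≈ (⟦++3⟧ [] Θ x Δ) (⟦++3⟧′ [] x Θ Δ)

  whisker-σσ : ∀ {a b c d} → whisker a (σ c b) d ∘ whisker a (σ b c) d ≈ id {a ++ ((b ++ c) ++ d)}
  whisker-σσ {a} {b} {c} {d} =
    whisker a (σ c b) d ∘ whisker a (σ b c) d ≈⟨ whisker-∘ ⟨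
    whisker a (σ c b ∘ σ b c) d               ≈⟨ whisker-cong refl σ-involutive refl ⟩
    whisker a id d                            ≈⟨ whisker-id ⟩
    id                                        ∎

  identity-var : ∀ {l} x A → IsIdentity ⟦ var {l} {x} {A} ⟧
  identity-var x A = identity-cast _ refl id

  ⟦𝟙-E⟧ : ∀ {a} (ns : Names a) {x d Δ A t} (p : Distinct (qctx a ns ++ x ∶⟨ d ⟩ 𝟙 ∷ Δ))
          (E : qctx a ns ++ Δ ⊢ₑ t ∶ A) → ⟦ 𝟙-E ns p E ⟧ₑ ≈ ⟦ E ⟧ₑ
  ⟦𝟙-E⟧ {a} ns {x} {d} {Δ} p E =
    ⟦ 𝟙-E ns p E ⟧ₑ  ≈⟨ ⟦from-front⟧ [] Θ D (moveˡ-≈ Θ z Δ) ⟩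
    ⟦ D ⟧ ∘ f        ≈⟨ ∘-elimʳ (≈-trans (moveˡ-≈ Θ z Δ)
                          (≈-trans (whisker-cong refl (σ-[]ʳ ⟦ Θ ⟧ᶜ) refl) whisker-id)) ⟩
    ⟦ D ⟧            ≈⟨ ⟦regrade⟧ (+-identityʳ d) D₀ ⟩
    ⟦ D₀ ⟧           ≈⟨ cast-≈ (sym (⟦+ᶜ++⟧ d [ x ∶⟨ 0# ⟩ 𝟙 ] (Θ ++ Δ))) refl ⟩
    Shift₁ d ⟦ V ⟧ ⊗₁ ⟦ E ⟧ₑ ≈⟨ ⊗-cong (identity-≈ (identity-Shift₁ d (identity-var {extended} x 𝟙))) ≈-refl ⟩
    id {[]} ⊗₁ ⟦ E ⟧ₑ ≈⟨ ⊗-identityˡ ⟩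
    ⟦ E ⟧ₑ           ∎
    where
    open RealNumbers ℛ
    Θ = qctx a ns
    z = x ∶⟨ d ⟩ 𝟙
    f = moveˡ Θ z Δ
    V = var {l = extended} {x} {𝟙}
    D₀ = 𝟙-E {Γ = [ x ∶⟨ 0# ⟩ 𝟙 ]} d (distinct-to-front Θ p) V (fromₑ E)
    D = regrade (+-identityʳ d) D₀

  ⟦□-E⟧ : ∀ {a} (ns : Names a) {x z d e Δ A B t} (p : Distinct (qctx a ns ++ z ∶⟨ d ⟩ □ e A ∷ Δ))
          (E : qctx a ns ++ x ∶⟨ _ ⟩ A ∷ Δ ⊢ₑ t ∶ B) → ⟦ □-E ns {x} {z} {d} {e} p E ⟧ₑ ≈ ⟦ E ⟧ₑ
  ⟦□-E⟧ {a} ns {x} {z} {d} {e} {Δ} {A} p E =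
    ⟦ □-E ns p E ⟧ₑ     ≈⟨ ⟦from-front⟧ [] Θ D (moveˡ-≈ Θ z′ Δ) ⟩
    ⟦ D ⟧ ∘ f           ≈⟨ ∘-cong (≈-trans (⟦regrade⟧ (d+e-e≡d d e) D₀) (∘-elimʳ (identity-≈ i))) (≈-sym (cast-≈ refl o)) ⟩
    ⟦ D₁ ⟧ ∘ f′         ≈⟨ ∘-cong (⟦to-front⟧ [] Θ (fromₑ E) (moveʳ-≈ [] x′ Θ Δ)) ≈-refl ⟩
    (⟦ E ⟧ₑ ∘ g) ∘ f′   ≈⟨ assoc ⟩
    ⟦ E ⟧ₑ ∘ (g ∘ f′)   ≈⟨ ∘-elimʳ (≈-trans (∘-cong (moveʳ-≈ [] x′ Θ Δ)
                             (≈-trans (cast-≈ refl o) (≈-trans (moveˡ-≈ Θ z′ Δ)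
                               (whisker-cong refl (σ-cong refl o₀) refl)))) whisker-σσ) ⟩
    ⟦ E ⟧ₑ              ∎
    where
    open RealNumbers ℛ
    Θ = qctx a ns
    z′ = z ∶⟨ d ⟩ □ e A
    x′ = x ∶⟨ d + e ⟩ A
    o₀ : ⟦ z′ ⟧ᵈ ≡ ⟦ x′ ⟧ᵈ
    o₀ = Shift-Shift d e ⟦ A ⟧ᵗ
    o : ⟦ z′ ∷ Θ ++ Δ ⟧ᶜ ≡ ⟦ x′ ∷ Θ ++ Δ ⟧ᶜ
    o = cong (_++ ⟦ Θ ++ Δ ⟧ᶜ) o₀
    f = moveˡ Θ z′ Δ
    f′ = cast refl o f
    g = moveʳ [] x′ Θ Δ
    D₁ = to-front [] Θ (fromₑ E)
    D₀ = □-E {Γ = [ z ∶⟨ 0# ⟩ □ e A ]} (distinct-to-front Θ p) var D₁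
    D = regrade (d+e-e≡d d e) D₀
    i = identity-cast
          (sym (⟦+ᶜ++⟧ ((d + e) - e) [ z ∶⟨ 0# ⟩ □ e A ] (Θ ++ Δ)))
          (cong (_++ ⟦ Θ ++ Δ ⟧ᶜ) (trans (Shift-Shift ((d + e) - e) e ⟦ A ⟧ᵗ)
            (cong (λ x → Shift x ⟦ A ⟧ᵗ) (e-d+d≡e (d + e) e))))
          (identity-Shift₁ ((d + e) - e) (identity-var {extended} z (□ e A)) ⊗ id)

  ⟦⊗-E⟧ : ∀ {a} (ns : Names a) {x y z d Δ A B C t}
          (p : Distinct (qctx a ns ++ z ∶⟨ d ⟩ (A ⊗ B) ∷ Δ))
          (E : qctx a ns ++ x ∶⟨ d ⟩ A ∷ y ∶⟨ d ⟩ B ∷ Δ ⊢ₑ t ∶ C) → ⟦ ⊗-E ns p E ⟧ₑ ≈ ⟦ E ⟧ₑ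
  ⟦⊗-E⟧ {a} ns {x} {y} {z} {d} {Δ} {A} {B} p E =
    ⟦ ⊗-E ns p E ⟧ₑ            ≈⟨ ⟦from-front⟧ [] Θ D (moveˡ-≈ Θ z′ Δ) ⟩
    ⟦ D ⟧ ∘ f                  ≈⟨ ∘-cong (≈-trans (⟦regrade⟧ (+-identityʳ d) D₀) (∘-elimʳ (identity-≈ i))) (≈-sym (cast-≈ refl o)) ⟩
    ⟦ D₁ ⟧ ∘ f′                ≈⟨ ∘-cong (⟦to-front⟧ [ x′ ] Θ D₂ (moveʳ-≈ [ x′ ] y′ Θ Δ)) ≈-refl ⟩
    (⟦ D₂ ⟧ ∘ h) ∘ f′          ≈⟨ ∘-cong (∘-cong (⟦to-front⟧ [] Θ (fromₑ E) (moveʳ-≈ [] x′ Θ (y′ ∷ Δ))) ≈-refl) ≈-refl ⟩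
    ((⟦ E ⟧ₑ ∘ g) ∘ h) ∘ f′    ≈⟨ ≈-trans (∘-cong assoc ≈-refl) assoc ⟩
    ⟦ E ⟧ₑ ∘ ((g ∘ h) ∘ f′)    ≈⟨ ∘-elimʳ (≈-trans (∘-cong gh f′≈) whisker-σσ) ⟩
    ⟦ E ⟧ₑ                     ∎
    where
    open RealNumbers ℛ
    Θ = qctx a ns
    z′ = z ∶⟨ d ⟩ (A ⊗ B)
    x′ = x ∶⟨ d ⟩ A
    y′ = y ∶⟨ d ⟩ B
    o₀ : ⟦ z′ ⟧ᵈ ≡ ⟦ x′ ⟧ᵈ ++ ⟦ y′ ⟧ᵈ
    o₀ = Shift-++ d ⟦ A ⟧ᵗ ⟦ B ⟧ᵗ
    o : ⟦ z′ ∷ Θ ++ Δ ⟧ᶜ ≡ ⟦ x′ ∷ y′ ∷ Θ ++ Δ ⟧ᶜ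
    o = trans (cong (_++ ⟦ Θ ++ Δ ⟧ᶜ) o₀) (++-assoc ⟦ x′ ⟧ᵈ ⟦ y′ ⟧ᵈ ⟦ Θ ++ Δ ⟧ᶜ)
    f = moveˡ Θ z′ Δ
    f′ = cast refl o f
    f′≈ : f′ ≈ whisker [] (σ ⟦ Θ ⟧ᶜ (⟦ x′ ⟧ᵈ ++ ⟦ y′ ⟧ᵈ)) ⟦ Δ ⟧ᶜ
    f′≈ = ≈-trans (cast-≈ refl o) (≈-trans (moveˡ-≈ Θ z′ Δ)
            (whisker-cong refl (σ-cong refl o₀) refl))
    g = moveʳ [] x′ Θ (y′ ∷ Δ)
    h = moveʳ [ x′ ] y′ Θ Δ
    D₂ = to-front [] Θ (fromₑ E)
    D₁ = to-front [ x′ ] Θ D₂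
    D₀ = ⊗-E {Γ = [ z ∶⟨ 0# ⟩ (A ⊗ B) ]} (distinct-to-front Θ p) var D₁
    D = regrade (+-identityʳ d) D₀
    i = identity-cast
          (sym (⟦+ᶜ++⟧ d [ z ∶⟨ 0# ⟩ (A ⊗ B) ] (Θ ++ Δ)))
          (trans (cong (_++ ⟦ Θ ++ Δ ⟧ᶜ) (Shift-++ d ⟦ A ⟧ᵗ ⟦ B ⟧ᵗ))
            (++-assoc (Shift d ⟦ A ⟧ᵗ) (Shift d ⟦ B ⟧ᵗ) ⟦ Θ ++ Δ ⟧ᶜ))
          (identity-Shift₁ d (identity-var {extended} z (A ⊗ B)) ⊗ id)
    a₁ = sym (++-assoc ⟦ x′ ⟧ᵈ ⟦ Θ ⟧ᶜ ⟦ y′ ⟧ᵈ)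
    h₁ = cast refl a₁ (id {⟦ x′ ⟧ᵈ} ⊗₁ σ ⟦ y′ ⟧ᵈ ⟦ Θ ⟧ᶜ)
    g₁ = σ ⟦ x′ ⟧ᵈ ⟦ Θ ⟧ᶜ ⊗₁ id {⟦ y′ ⟧ᵈ}
    gh : g ∘ h ≈ whisker [] (σ (⟦ x′ ⟧ᵈ ++ ⟦ y′ ⟧ᵈ) ⟦ Θ ⟧ᶜ) ⟦ Δ ⟧ᶜ
    gh = ≈-sym (
      whisker [] (σ (⟦ x′ ⟧ᵈ ++ ⟦ y′ ⟧ᵈ) ⟦ Θ ⟧ᶜ) ⟦ Δ ⟧ᶜ
        ≈⟨ whisker-cong refl (σ-hexagonʳ (cast-≈ refl a₁) ≈-refl) refl ⟩
      whisker [] (g₁ ∘ h₁) ⟦ Δ ⟧ᶜ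
        ≈⟨ whisker-∘ ⟩
      whisker [] g₁ ⟦ Δ ⟧ᶜ ∘ whisker [] h₁ ⟦ Δ ⟧ᶜ
        ≈⟨ ∘-cong (≈-trans whisker-⊗-id (≈-sym (moveʳ-≈ [] x′ Θ (y′ ∷ Δ))))
             (≈-trans (whisker-cong refl (cast-≈ refl a₁) refl)
               (≈-trans whisker-id-⊗ (≈-trans (whisker-cong (sym (++-identityʳ ⟦ x′ ⟧ᵈ)) ≈-refl refl)
                 (≈-sym (moveʳ-≈ [ x′ ] y′ Θ Δ))))) ⟩
      g ∘ h ∎)

  -- Names

  Unique-resp-↭ : {xs ys : List Name} → xs ↭ ys → Unique xs → Unique ys
  Unique-resp-↭ p = PermSetoid.Unique-resp-↭ (setoid Name) (↭⇒↭ₛ p)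

  take-length-++ : ∀ {n} (ys {zs} : List Name) → length ys ≡ n → take n (ys ++ zs) ≡ ys
  take-length-++ []       refl = refl
  take-length-++ (y ∷ ys) refl = cong (y ∷_) (take-length-++ ys refl)

  drop-length-++ : ∀ {n} (ys {zs} : List Name) → length ys ≡ n → drop n (ys ++ zs) ≡ zs
  drop-length-++ []       refl = refl
  drop-length-++ (y ∷ ys) refl = drop-length-++ ys refl

  split-length : ∀ (a b : Obj) (xs : List Name) → length xs ≡ length (a ++ b) →
                 ∃[ ys ] ∃[ zs ] xs ≡ ys ++ zs × length ys ≡ length a × length zs ≡ length b
  split-length []      b xs       p = [] , xs , refl , refl , p
  split-length (_ ∷ a) b (x ∷ xs) p with split-length a b xs (suc-injective p)
  ... | ys , zs , refl , q , r = x ∷ ys , zs , refl , cong suc q , r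

  names : ∀ {a} → Names a → List Name
  names = reduce (λ n → n)

  length-names : ∀ {a} (ns : Names a) → length (names ns) ≡ length a
  length-names []       = refl
  length-names (n ∷ ns) = cong suc (length-names ns)

  names-++⁺ : ∀ {a b} (ms : Names a) (ns : Names b) → names (++⁺ ms ns) ≡ names ms ++ names ns
  names-++⁺ []       ns = refl
  names-++⁺ (m ∷ ms) ns = cong (m ∷_) (names-++⁺ ms ns)

  names-++⁻ˡ : ∀ a {b} (ns : Names (a ++ b)) → names (++⁻ˡ a ns) ≡ take (length a) (names ns)
  names-++⁻ˡ []      ns       = refl
  names-++⁻ˡ (_ ∷ a) (n ∷ ns) = cong (n ∷_) (names-++⁻ˡ a ns)

  names-++⁻ʳ : ∀ a {b} (ns : Names (a ++ b)) → names (++⁻ʳ a ns) ≡ drop (length a) (names ns)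
  names-++⁻ʳ []      ns       = refl
  names-++⁻ʳ (_ ∷ a) (n ∷ ns) = names-++⁻ʳ a ns

  names-map⁻ : {A : Set} {f : A → _} (as : List A) (ns : Names (map f as)) →
               reduce (λ n → n) (map⁻ {P = λ _ → Name} {xs = as} ns) ≡ names ns
  names-map⁻ []       []       = refl
  names-map⁻ (_ ∷ as) (n ∷ ns) = cong (n ∷_) (names-map⁻ as ns)

  names-map⁺ : {A : Set} {f : A → _} {as : List A} (ns : All (λ _ → Name) as) →
               names (map⁺ {P = λ _ → Name} {f = f} ns) ≡ reduce (λ n → n) ns
  names-map⁺ []       = refl
  names-map⁺ (n ∷ ns) = cong (n ∷_) (names-map⁺ ns)

  names-qctx : ∀ a (ns : Names a) → map name (qctx a ns) ≡ names ns
  names-qctx []      []       = refl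
  names-qctx (_ ∷ a) (n ∷ ns) = cong (n ∷_) (names-qctx a ns)

  -- The function transport on bare lists of names, so that it can be compared
  -- along _≈_ between morphisms whose endpoints agree only propositionally.
  permute : ∀ {a b} → Hom a b → List Name → List Name
  permute id xs = xs
  permute (g ∘ f) xs = permute g (permute f xs)
  permute (_⊗₁_ {a} f g) xs =
    permute f (take (length a) xs) ++ permute g (drop (length a) xs)
  permute (σ a b) xs = drop (length a) xs ++ take (length a) xs
  permute (delay _ _ _ _) xs = xs
  permute (φ _ _) xs = xs

  names-transport : ∀ {a b} (f : Hom a b) (ns : Names a) →
                    names (transport f ns) ≡ permute f (names ns)
  names-transport id ns = refl
  names-transport (g ∘ f) ns =
    trans (names-transport g (transport f ns)) (cong (permute g) (names-transport f ns))
  names-transport (_⊗₁_ {a} f g) ns =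
    trans (names-++⁺ (transport f (++⁻ˡ a ns)) (transport g (++⁻ʳ a ns)))
      (cong₂ _++_
        (trans (names-transport f (++⁻ˡ a ns)) (cong (permute f) (names-++⁻ˡ a ns)))
        (trans (names-transport g (++⁻ʳ a ns)) (cong (permute g) (names-++⁻ʳ a ns))))
  names-transport (σ a b) ns =
    trans (names-++⁺ (++⁻ʳ a ns) (++⁻ˡ a ns)) (cong₂ _++_ (names-++⁻ʳ a ns) (names-++⁻ˡ a ns))
  names-transport (delay _ _ _ _) (n ∷ []) = refl
  names-transport (φ G x) ns = trans (names-map⁺ (map⁻ ns)) (names-map⁻ (qubits G) ns)
    where open GateSet 𝒮

  permute-↭ : ∀ {a b} (f : Hom a b) xs → xs ↭ permute f xs
  permute-↭ id xs = ↭-refl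
  permute-↭ (g ∘ f) xs = ↭-trans (permute-↭ f xs) (permute-↭ g (permute f xs))
  permute-↭ (_⊗₁_ {a} f g) xs =
    ↭-trans (↭-reflexive (sym (take++drop≡id (length a) xs)))
      (Perm.++⁺ (permute-↭ f (take (length a) xs)) (permute-↭ g (drop (length a) xs)))
  permute-↭ (σ a b) xs =
    ↭-trans (↭-reflexive (sym (take++drop≡id (length a) xs)))
      (Perm.++-comm (take (length a) xs) (drop (length a) xs))
  permute-↭ (delay _ _ _ _) xs = ↭-refl
  permute-↭ (φ _ _) xs = ↭-refl

  Pointwise-take : ∀ {R : Name → Name → Set} n {xs ys} →
                   Pointwise R xs ys → Pointwise R (take n xs) (take n ys)
  Pointwise-take zero    rs       = []
  Pointwise-take (suc n) []       = []
  Pointwise-take (suc n) (r ∷ rs) = r ∷ Pointwise-take n rs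

  Pointwise-drop : ∀ {R : Name → Name → Set} n {xs ys} →
                   Pointwise R xs ys → Pointwise R (drop n xs) (drop n ys)
  Pointwise-drop zero    rs       = rs
  Pointwise-drop (suc n) []       = []
  Pointwise-drop (suc n) (r ∷ rs) = Pointwise-drop n rs

  permute-Pointwise : ∀ {R : Name → Name → Set} {a b} (f : Hom a b) {xs ys} →
                      Pointwise R xs ys → Pointwise R (permute f xs) (permute f ys)
  permute-Pointwise id rs = rs
  permute-Pointwise (g ∘ f) rs = permute-Pointwise g (permute-Pointwise f rs)
  permute-Pointwise (_⊗₁_ {a} f g) rs =
    Pointwise.++⁺ (permute-Pointwise f (Pointwise-take (length a) rs))
                  (permute-Pointwise g (Pointwise-drop (length a) rs))
  permute-Pointwise (σ a b) rs =
    Pointwise.++⁺ (Pointwise-drop (length a) rs) (Pointwise-take (length a) rs)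
  permute-Pointwise (delay _ _ _ _) rs = rs
  permute-Pointwise (φ _ _) rs = rs

  length-endpoints : ∀ {a b} → Hom a b → length a ≡ length b
  length-endpoints id = refl
  length-endpoints (g ∘ f) = trans (length-endpoints f) (length-endpoints g)
  length-endpoints (_⊗₁_ {a} {b} f g) =
    trans (length-++ a) (trans (cong₂ Data.Nat._+_ (length-endpoints f) (length-endpoints g))
      (sym (length-++ b)))
  length-endpoints (σ a b) =
    trans (length-++ a) (trans (+-comm (length a) (length b)) (sym (length-++ b)))
  length-endpoints (delay _ _ _ _) = refl
  length-endpoints (φ G x) = trans (length-map _ (qubits G)) (sym (length-map _ (qubits G)))
    where open GateSet 𝒮

  length-permute : ∀ {a b} (f : Hom a b) {xs} → length xs ≡ length a →
                   length (permute f xs) ≡ length b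
  length-permute f {xs} p =
    trans (sym (Perm.↭-length (permute-↭ f xs))) (trans p (length-endpoints f))

  permute-⊗ : ∀ {a b c d} (f : Hom a b) (g : Hom c d) ys {zs} → length ys ≡ length a →
              permute (f ⊗₁ g) (ys ++ zs) ≡ permute f ys ++ permute g zs
  permute-⊗ f g ys p =
    cong₂ _++_ (cong (permute f) (take-length-++ ys p)) (cong (permute g) (drop-length-++ ys p))

  permute-σ : ∀ a b ys {zs} → length ys ≡ length a → permute (σ a b) (ys ++ zs) ≡ zs ++ ys
  permute-σ a b ys p = cong₂ _++_ (drop-length-++ ys p) (take-length-++ ys p)

  permute-≈ : ∀ {a b a′ b′} {f : Hom a b} {g : Hom a′ b′} → f ≈ g →
              ∀ xs → length xs ≡ length a → permute f xs ≡ permute g xs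
  permute-≈ ≈-refl xs p = refl
  permute-≈ (≈-sym e) xs p =
    sym (permute-≈ e xs (trans p (cong length (sym (proj₁ (≈-endpoints e))))))
  permute-≈ (≈-trans e e′) xs p =
    trans (permute-≈ e xs p)
          (permute-≈ e′ xs (trans p (cong length (proj₁ (≈-endpoints e)))))
  permute-≈ (∘-cong {f = f} {g′ = g′} e e′) xs p =
    trans (permute-≈ e (permute f xs) (length-permute f p))
          (cong (permute g′) (permute-≈ e′ xs p))
  permute-≈ (⊗-cong {a} {c = c} {f = f} {g} {f′} {g′} e e′) xs p
    with ys , zs , refl , q , r ← split-length a c xs p =
    trans (permute-⊗ f g ys q)
      (trans (cong₂ _++_ (permute-≈ e ys q) (permute-≈ e′ zs r))
        (sym (permute-⊗ f′ g′ ys (trans q (cong length (proj₁ (≈-endpoints e)))))))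
  permute-≈ identityˡ xs p = refl
  permute-≈ identityʳ xs p = refl
  permute-≈ assoc xs p = refl
  permute-≈ (⊗-id {a}) xs p = take++drop≡id (length a) xs
  permute-≈ (⊗-∘ {a} {a′ = a′} {f = f} {g} {f′} {g′}) xs p
    with ys , zs , refl , q , r ← split-length a a′ xs p =
    trans (permute-⊗ (g ∘ f) (g′ ∘ f′) ys q)
      (sym (trans (cong (permute (g ⊗₁ g′)) (permute-⊗ f f′ ys q))
        (permute-⊗ g g′ (permute f ys) (length-permute f q))))
  permute-≈ ⊗-identityˡ xs p = refl
  permute-≈ (⊗-identityʳ {a} {f = f}) xs p
    with ys , [] , refl , q , refl ← split-length a [] xs p =
    trans (permute-⊗ f (id {[]}) ys q)
      (trans (++-identityʳ (permute f ys)) (cong (permute f) (sym (++-identityʳ ys))))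
  permute-≈ (⊗-assoc {a} {c = c} {a′ = a′} {f = f} {g} {h}) xs p
    with us , ws , refl , q , r ← split-length (a ++ c) a′ xs p
    with us , vs , refl , s , t ← split-length a c us q =
    trans (permute-⊗ (f ⊗₁ g) h (us ++ vs) q)
      (trans (cong (_++ permute h ws) (permute-⊗ f g us s))
        (trans (++-assoc (permute f us) (permute g vs) (permute h ws))
          (sym (trans (cong (permute (f ⊗₁ (g ⊗₁ h))) (++-assoc us vs ws))
            (trans (permute-⊗ f (g ⊗₁ h) us s)
              (cong (permute f us ++_) (permute-⊗ g h vs t)))))))
  permute-≈ (σ-natural {a} {b} {a′} {b′} {f} {g}) xs p
    with ys , zs , refl , q , r ← split-length a a′ xs p =
    trans (cong (permute (σ b b′)) (permute-⊗ f g ys q))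
      (trans (permute-σ b b′ (permute f ys) (length-permute f q))
        (sym (trans (cong (permute (g ⊗₁ f)) (permute-σ a a′ ys q)) (permute-⊗ g f zs r))))
  permute-≈ (σ-involutive {a} {b}) xs p
    with ys , zs , refl , q , r ← split-length a b xs p =
    trans (cong (permute (σ b a)) (permute-σ a b ys q)) (permute-σ b a zs r)
  permute-≈ (σ-hexagon {a} {b} {c} {f = f} {g} e e′) xs p
    with us , vws , refl , q , r ← split-length a (b ++ c) xs p
    with vs , ws , refl , s , t ← split-length b c vws r =
    trans (permute-σ a (b ++ c) us q) (trans (++-assoc vs ws us) (sym (
      trans (cong (permute g) f-eq)
        (trans (permute-≈ e′ (vs ++ (us ++ ws)) len)
          (trans (permute-⊗ (id {b}) (σ a c) vs s) (cong (vs ++_) (permute-σ a c us q)))))))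
    where
    f-eq : permute f (us ++ vs ++ ws) ≡ vs ++ (us ++ ws)
    f-eq =
      trans (permute-≈ e (us ++ vs ++ ws) (trans p
          (cong length (trans (sym (++-assoc a b c)) (sym (proj₁ (≈-endpoints e)))))))
        (trans (cong (permute (σ a b ⊗₁ id {c})) (sym (++-assoc us vs ws)))
          (trans (permute-⊗ (σ a b) (id {c}) (us ++ vs) (trans (length-++ us)
              (trans (cong₂ Data.Nat._+_ q s) (sym (length-++ a)))))
            (trans (cong (_++ ws) (permute-σ a b us q)) (++-assoc vs us ws))))
    len : length (vs ++ (us ++ ws)) ≡ _
    len = trans (cong length (sym f-eq)) (length-permute f
      (trans p (cong length (trans (sym (++-assoc a b c)) (sym (proj₁ (≈-endpoints e)))))))

  qctx-++ : ∀ a b (ns : Names (a ++ b)) → qctx (a ++ b) ns ≡ qctx a (++⁻ˡ a ns) ++ qctx b (++⁻ʳ a ns)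
  qctx-++ []            b ns       = refl
  qctx-++ ((d , q) ∷ a) b (n ∷ ns) = cong (n ∶⟨ d ⟩ qubit q ∷_) (qctx-++ a b ns)

  qctx-Shift : ∀ d a (ns : Names (Shift d a)) → qctx (Shift d a) ns ≡ d +ᶜ qctx a (map⁻ ns)
  qctx-Shift d []            []       = refl
  qctx-Shift d ((e , q) ∷ a) (n ∷ ns) = cong (_ ∷_) (qctx-Shift d a ns)

  qctx-∷ʳ : ∀ a (ns : Names a) {n d q} →
            qctx (a ++ [ (d , q) ]) (++⁺ ns (n ∷ [])) ≡ qctx a ns ++ [ n ∶⟨ d ⟩ qubit q ]
  qctx-∷ʳ []      []       = refl
  qctx-∷ʳ (_ ∷ a) (m ∷ ns) = cong (_ ∷_) (qctx-∷ʳ a ns)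

  map-name-+ᶜ : ∀ d Γ → map name (d +ᶜ Γ) ≡ map name Γ
  map-name-+ᶜ d Γ = sym (map-∘ Γ)

  distinct-+ᶜ : ∀ d Γ → Distinct Γ → Distinct (d +ᶜ Γ)
  distinct-+ᶜ d Γ = subst Unique (sym (map-name-+ᶜ d Γ))

  Fresh : Name → Context → Set
  Fresh x = All (λ v → x ≢ name v)

  distinct-split : ∀ Θ {v Δ} → Distinct (Θ ++ v ∷ Δ) →
                   Fresh (name v) Θ × Fresh (name v) Δ × Distinct (Θ ++ Δ)
  distinct-split Θ p with f ∷ u ← distinct-to-front Θ p =
    let g , h = ++⁻ Θ (map⁻ f) in g , h , u

  distinct-insert : ∀ Θ {v Δ} → Fresh (name v) (Θ ++ Δ) → Distinct (Θ ++ Δ) → Distinct (Θ ++ v ∷ Δ)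
  distinct-insert Θ {v} {Δ} f u =
    Unique-resp-↭ (↭-sym (Perm.map⁺ name (Perm.shift v Θ Δ))) (map⁺ f ∷ u)

  distinct : ∀ {Γ A} {t : Term annotated} → Γ ⊢ t ∶ A → Distinct Γ
  distinct (swap Γ {x} {y} {Δ} D) =
    Unique-resp-↭ (Perm.map⁺ name (Perm.++⁺ˡ Γ (_↭_.swap x y ↭-refl))) (distinct D)
  distinct var             = [] ∷ []
  distinct 𝟙-I             = []
  distinct (𝟙-E d p D E)   = p
  distinct (gate p Ds)     = p
  distinct (⊗-I p D E)     = p
  distinct (⊗-E p D E)     = p
  distinct (□-I {Γ = Γ} d D)       = distinct-+ᶜ d Γ (distinct D)
  distinct (□-E p D E)     = p
  distinct (delay {Γ = Γ} d d≥0 D) = distinct-+ᶜ _ Γ (distinct D)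
  distinct (let′ p D E)    = p

  distinctₙ : ∀ {Γ t A} → Γ ⊢ₙ t ∶ A → Distinct Γ
  distinctₙ 𝟙-I               = []
  distinctₙ var               = [] ∷ []
  distinctₙ (⊗-I p D E)       = p
  distinctₙ (□-I {Γ = Γ} d D) = distinct-+ᶜ d Γ (distinctₙ D)

  names-transport-qctx : ∀ {a b} (ns : Names a) (c : Hom a b) →
                         map name (qctx b (transport c ns)) ≡ permute c (names ns)
  names-transport-qctx {b = b} ns c =
    trans (names-qctx b (transport c ns)) (names-transport c ns)

  distinctₑ : ∀ {Γ t A} → Γ ⊢ₑ t ∶ A → Distinct Γ
  distinctₑ (𝟙-E ns p E) = p
  distinctₑ (⊗-E ns p E) = p
  distinctₑ (□-E ns p E) = p
  distinctₑ (circ {a} ns c D) =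
    subst Unique (sym (names-qctx a ns))
      (Unique-resp-↭ (↭-sym (permute-↭ c (names ns)))
        (subst Unique (names-transport-qctx ns c) (distinctₙ D)))

  identity-fromₙ : ∀ {Γ t A} (D : Γ ⊢ₙ t ∶ A) → IsIdentity ⟦ fromₙ D ⟧
  identity-fromₙ 𝟙-I           = id
  identity-fromₙ (var {x} {q}) = identity-var {extended} x (qubit q)
  identity-fromₙ (⊗-I {Γ} {Δ} p D E) =
    identity-cast (sym (⟦++⟧ Γ Δ)) refl (identity-fromₙ D ⊗ identity-fromₙ E)
  identity-fromₙ (□-I {Γ} d D) =
    identity-cast (sym (⟦+ᶜ⟧ d Γ)) refl (identity-Shift₁ d (identity-fromₙ D))

  ⟦circ⟧ : ∀ {a b} (ns : Names a) (c : Hom a b) {t B} (D : qctx b (transport c ns) ⊢ₙ t ∶ B) →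
           ⟦ circ ns c D ⟧ₑ ≈ c
  ⟦circ⟧ {a} {b} ns c D =
    ≈-trans (∘-elimˡ (identity-≈ (identity-fromₙ D)))
            (cast-≈ (sym (⟦qctx⟧ a ns)) (sym (⟦qctx⟧ b (transport c ns))))

  -- Existence

  readback : ∀ B (ns : Names ⟦ B ⟧ᵗ) → Unique (names ns) → ∃[ t ] qctx ⟦ B ⟧ᵗ ns ⊢ₙ t ∶ B
  readback 𝟙 [] u = ⋆ , 𝟙-I
  readback (qubit q) (n ∷ []) u = var n , var
  readback (A ⊗ B) ns u =
    let s , D = readback A (++⁻ˡ ⟦ A ⟧ᵗ ns)
                  (subst Unique (sym (names-++⁻ˡ ⟦ A ⟧ᵗ ns)) (AllPairs.take⁺ n u))
        t , E = readback B (++⁻ʳ ⟦ A ⟧ᵗ ns)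
                  (subst Unique (sym (names-++⁻ʳ ⟦ A ⟧ᵗ ns)) (AllPairs.drop⁺ n u))
    in pair s t , subst (_⊢ₙ pair s t ∶ A ⊗ B) (sym eq)
         (⊗-I (subst Distinct eq (subst Unique (sym (names-qctx _ ns)) u)) D E)
    where
    n  = length ⟦ A ⟧ᵗ
    eq = qctx-++ ⟦ A ⟧ᵗ ⟦ B ⟧ᵗ ns
  readback (□ d B) ns u =
    let t , D = readback B (map⁻ ns) (subst Unique (sym (names-map⁻ ⟦ B ⟧ᵗ ns)) u)
    in box d t , subst (_⊢ₙ box d t ∶ □ d B) (sym (qctx-Shift d ⟦ B ⟧ᵗ ns)) (□-I d D)

  NormalForm : ∀ Γ C → Hom ⟦ Γ ⟧ᶜ ⟦ C ⟧ᵗ → Set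
  NormalForm Γ C f = ∃[ u ] Σ[ E ∈ (Γ ⊢ₑ u ∶ C) ] f ≈ ⟦ E ⟧ₑ

  Normalisable : Type → Context → Set
  Normalisable C Γ = Distinct Γ → (f : Hom ⟦ Γ ⟧ᶜ ⟦ C ⟧ᵗ) → NormalForm Γ C f

  QubitsNormalisable : Type → Context → Set
  QubitsNormalisable C Δ = ∀ a (ns : Names a) → Normalisable C (qctx a ns ++ Δ)

  normalise-circ : ∀ {C} → QubitsNormalisable C []
  normalise-circ {C} a ns =
    subst (Normalisable C) (sym (++-identityʳ (qctx a ns))) λ u f →
      let c = cast (⟦qctx⟧ a ns) refl f
          t , D = readback C (transport c ns)
            (subst Unique (sym (names-transport c ns))
              (Unique-resp-↭ (permute-↭ c (names ns)) (subst Unique (names-qctx a ns) u)))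
      in t after c , circ ns c D ,
         ≈-sym (≈-trans (⟦circ⟧ ns c D) (cast-≈ (⟦qctx⟧ a ns) refl))

  fresh : ∀ Γ → ∃[ x ] Fresh x Γ
  fresh Γ = suc (max 0 (map name Γ)) ,
    map⁻ (All.map (λ x≤m x≡ → <⇒≢ (s≤s x≤m) (sym x≡)) (xs≤max 0 (map name Γ)))

  ⟦++-cong⟧ : ∀ Θ {Δ Δ′} → ⟦ Δ ⟧ᶜ ≡ ⟦ Δ′ ⟧ᶜ → ⟦ Θ ++ Δ ⟧ᶜ ≡ ⟦ Θ ++ Δ′ ⟧ᶜ
  ⟦++-cong⟧ Θ {Δ} {Δ′} p = trans (⟦++⟧ Θ Δ) (trans (cong (⟦ Θ ⟧ᶜ ++_) p) (sym (⟦++⟧ Θ Δ′)))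

  normalise-∷ : ∀ {C} A {x d Δ} → QubitsNormalisable C Δ → QubitsNormalisable C (x ∶⟨ d ⟩ A ∷ Δ)
  normalise-∷ 𝟙 N a ns p f =
    let Θ = qctx a ns
        _ , _ , p′ = distinct-split Θ p
        o = ⟦++-cong⟧ Θ refl
        u , E , e = N a ns p′ (cast o refl f)
    in _ , 𝟙-E ns p E , ≈-trans (≈-sym (cast-≈ o refl)) (≈-trans e (≈-sym (⟦𝟙-E⟧ ns p E)))
  normalise-∷ {C} (qubit q) {x} {d} {Δ} N a ns =
    subst (Normalisable C)
      (trans (cong (_++ Δ) (qctx-∷ʳ a ns)) (++-assoc (qctx a ns) [ x ∶⟨ d ⟩ qubit q ] Δ))
      (N (a ++ [ (d , q) ]) (++⁺ ns (x ∷ [])))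
  normalise-∷ (A ⊗ B) {x} {d} {Δ} N a ns p f =
    let Θ = qctx a ns
        y , y-fresh = fresh (x ∶⟨ d ⟩ A ∷ Θ ++ Δ)
        x-freshΘ , x-freshΔ , p′ = distinct-split Θ p
        p″ = distinct-insert Θ {x ∶⟨ d ⟩ A} {y ∶⟨ d ⟩ B ∷ Δ}
               (++⁺ x-freshΘ ((λ x≡y → All.head y-fresh (sym x≡y)) ∷ x-freshΔ))
               (distinct-insert Θ (All.tail y-fresh) p′)
        o = ⟦++-cong⟧ Θ (trans (cong (_++ ⟦ Δ ⟧ᶜ) (Shift-++ d ⟦ A ⟧ᵗ ⟦ B ⟧ᵗ))
                            (++-assoc (Shift d ⟦ A ⟧ᵗ) (Shift d ⟦ B ⟧ᵗ) ⟦ Δ ⟧ᶜ))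
        u , E , e = normalise-∷ A (normalise-∷ B N) a ns p″ (cast o refl f)
    in _ , ⊗-E ns p E , ≈-trans (≈-sym (cast-≈ o refl)) (≈-trans e (≈-sym (⟦⊗-E⟧ ns p E)))
  normalise-∷ (□ e A) {x} {d} {Δ} N a ns p f =
    let Θ = qctx a ns
        x-freshΘ , x-freshΔ , p′ = distinct-split Θ p
        p″ = distinct-insert Θ {x ∶⟨ _ ⟩ A} (++⁺ x-freshΘ x-freshΔ) p′
        o = ⟦++-cong⟧ Θ (cong (_++ ⟦ Δ ⟧ᶜ) (Shift-Shift d e ⟦ A ⟧ᵗ))
        u , E , e = normalise-∷ A N a ns p″ (cast o refl f)
    in _ , □-E ns p E , ≈-trans (≈-sym (cast-≈ o refl)) (≈-trans e (≈-sym (⟦□-E⟧ ns p E)))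

  normalise : ∀ {C} Δ → QubitsNormalisable C Δ
  normalise []               = normalise-circ
  normalise (x ∶⟨ d ⟩ A ∷ Δ) = normalise-∷ A (normalise Δ)

  -- Uniqueness

  infix 4 _⊢_≈ᵈ_ _⊢_≈ᶜ_

  data _⊢_≈ᵈ_ (ρ : Binders) : Declaration → Declaration → Set where
    named : ∀ {x y d A} → ρ ⊢ᵛ x ≈ y → ρ ⊢ x ∶⟨ d ⟩ A ≈ᵈ y ∶⟨ d ⟩ A

  _⊢_≈ᶜ_ : Binders → Context → Context → Set
  ρ ⊢ Γ ≈ᶜ Γ′ = Pointwise (ρ ⊢_≈ᵈ_) Γ Γ′

  ≈ᶜ-refl : ∀ Γ → [] ⊢ Γ ≈ᶜ Γ
  ≈ᶜ-refl Γ = Pointwise.refl (named free)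

  ≈ᶜ-bind : ∀ {ρ x x′ Γ Γ′} → Fresh x Γ → Fresh x′ Γ′ → ρ ⊢ Γ ≈ᶜ Γ′ → (x , x′) ∷ ρ ⊢ Γ ≈ᶜ Γ′
  ≈ᶜ-bind []       []        []             = []
  ≈ᶜ-bind (f ∷ fs) (f′ ∷ fs′) (named r ∷ rs) =
    named (there (λ e → f (sym e)) (λ e → f′ (sym e)) r) ∷ ≈ᶜ-bind fs fs′ rs

  ≈ᶜ-names : ∀ {ρ Γ Γ′} → ρ ⊢ Γ ≈ᶜ Γ′ → Pointwise (ρ ⊢ᵛ_≈_) (map name Γ) (map name Γ′)
  ≈ᶜ-names []             = []
  ≈ᶜ-names (named r ∷ rs) = r ∷ ≈ᶜ-names rs

  Pointwise-++⁻ : ∀ {A : Set} {R : A → A → Set} xs xs′ {ys ys′} → length xs ≡ length xs′ →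
                  Pointwise R (xs ++ ys) (xs′ ++ ys′) → Pointwise R xs xs′ × Pointwise R ys ys′
  Pointwise-++⁻ []       []         p rs = [] , rs
  Pointwise-++⁻ (x ∷ xs) (x′ ∷ xs′) p (r ∷ rs) =
    let rs₁ , rs₂ = Pointwise-++⁻ xs xs′ (suc-injective p) rs in r ∷ rs₁ , rs₂

  lengthₙ : ∀ {Γ t A} → Γ ⊢ₙ t ∶ A → length Γ ≡ length ⟦ A ⟧ᵗ
  lengthₙ 𝟙-I = refl
  lengthₙ var = refl
  lengthₙ (⊗-I {Γ} {A = A} p D E) =
    trans (length-++ Γ) (trans (cong₂ Data.Nat._+_ (lengthₙ D) (lengthₙ E))
      (sym (length-++ ⟦ A ⟧ᵗ)))
  lengthₙ (□-I {Γ} {A} d D) =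
    trans (length-map _ Γ) (trans (lengthₙ D) (sym (length-map _ ⟦ A ⟧ᵗ)))

  uniqueₙ : ∀ {ρ Γ Γ′ t t′ A} → Γ ⊢ₙ t ∶ A → Γ′ ⊢ₙ t′ ∶ A →
            Pointwise (λ v w → ρ ⊢ᵛ name v ≈ name w) Γ Γ′ → ρ ⊢ t ≈α t′
  uniqueₙ 𝟙-I 𝟙-I rs = ⋆
  uniqueₙ var var (r ∷ []) = var r
  uniqueₙ (⊗-I {Γ} p D E) (⊗-I {Γ′} p′ D′ E′) rs =
    let rs₁ , rs₂ = Pointwise-++⁻ Γ Γ′ (trans (lengthₙ D) (sym (lengthₙ D′))) rs
    in pair (uniqueₙ D D′ rs₁) (uniqueₙ E E′ rs₂)
  uniqueₙ (□-I d D) (□-I .d D′) rs = box (uniqueₙ D D′ (Pointwise.map⁻ _ _ rs))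

  firstNonQubit : Context → Maybe Type
  firstNonQubit []                      = nothing
  firstNonQubit (_ ∶⟨ _ ⟩ qubit _ ∷ Γ)  = firstNonQubit Γ
  firstNonQubit (_ ∶⟨ _ ⟩ 𝟙 ∷ _)        = just 𝟙
  firstNonQubit (_ ∶⟨ _ ⟩ (A ⊗ B) ∷ _)  = just (A ⊗ B)
  firstNonQubit (_ ∶⟨ _ ⟩ □ d A ∷ _)    = just (□ d A)

  firstNonQubit-≈ᶜ : ∀ {ρ Γ Γ′} → ρ ⊢ Γ ≈ᶜ Γ′ → firstNonQubit Γ ≡ firstNonQubit Γ′
  firstNonQubit-≈ᶜ [] = refl
  firstNonQubit-≈ᶜ (named {A = 𝟙} _ ∷ rs)       = refl
  firstNonQubit-≈ᶜ (named {A = qubit _} _ ∷ rs) = firstNonQubit-≈ᶜ rs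
  firstNonQubit-≈ᶜ (named {A = _ ⊗ _} _ ∷ rs)   = refl
  firstNonQubit-≈ᶜ (named {A = □ _ _} _ ∷ rs)   = refl

  firstNonQubit-qctx : ∀ {a} (ns : Names a) Δ → firstNonQubit (qctx a ns ++ Δ) ≡ firstNonQubit Δ
  firstNonQubit-qctx []       Δ = refl
  firstNonQubit-qctx (n ∷ ns) Δ = firstNonQubit-qctx ns Δ

  firstNonQubit-unique : ∀ {ρ Δ Δ′ a a′} (ns : Names a) (ns′ : Names a′) →
                         ρ ⊢ qctx a ns ++ Δ ≈ᶜ qctx a′ ns′ ++ Δ′ →
                         firstNonQubit Δ ≡ firstNonQubit Δ′
  firstNonQubit-unique ns ns′ rs =
    trans (sym (firstNonQubit-qctx ns _))
      (trans (firstNonQubit-≈ᶜ rs) (firstNonQubit-qctx ns′ _))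

  data NonQubit : Type → Set where
    𝟙   : NonQubit 𝟙
    _⊗_ : ∀ A B → NonQubit (A ⊗ B)
    □   : ∀ d A → NonQubit (□ d A)

  ≈ᶜ-split : ∀ {ρ z z′ Δ Δ′ a a′} (ns : Names a) (ns′ : Names a′) →
             NonQubit (type z) → NonQubit (type z′) →
             ρ ⊢ qctx a ns ++ z ∷ Δ ≈ᶜ qctx a′ ns′ ++ z′ ∷ Δ′ →
             ρ ⊢ qctx a ns ≈ᶜ qctx a′ ns′ × ρ ⊢ z ≈ᵈ z′ × ρ ⊢ Δ ≈ᶜ Δ′
  ≈ᶜ-split []       []         p  p′ (r ∷ rs) = [] , r , rs
  ≈ᶜ-split []       (n ∷ ns)   () p′ (named _ ∷ _)
  ≈ᶜ-split (n ∷ ns) []         p  () (named _ ∷ _)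
  ≈ᶜ-split (n ∷ ns) (n′ ∷ ns′) p  p′ (r ∷ rs) =
    let rs₁ , r′ , rs₂ = ≈ᶜ-split ns ns′ p p′ rs in r ∷ rs₁ , r′ , rs₂

  unique-circ : ∀ {ρ a b a′ b′ t t′ B} (ns : Names a) (ns′ : Names a′) (c : Hom a b) (c′ : Hom a′ b′) →
                qctx b (transport c ns) ⊢ₙ t ∶ B → qctx b′ (transport c′ ns′) ⊢ₙ t′ ∶ B →
                ρ ⊢ qctx a ns ≈ᶜ qctx a′ ns′ → c ≈ c′ → ρ ⊢ t after c ≈α (t′ after c′)
  unique-circ {ρ} {a} {b} {a′} {b′} ns ns′ c c′ D D′ rs e =
    uniqueₙ D D′ (Pointwise.map⁻ name name rs′) after e
    where
    R : List Name → List Name → Set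
    R = Pointwise (ρ ⊢ᵛ_≈_)
    rs₀ : R (names ns) (names ns′)
    rs₀ = subst (R (names ns)) (names-qctx a′ ns′)
            (subst (λ xs → R xs _) (names-qctx a ns) (≈ᶜ-names rs))
    c≡c′ : permute c (names ns′) ≡ permute c′ (names ns′)
    c≡c′ = permute-≈ e (names ns′)
             (trans (length-names ns′) (cong length (sym (proj₁ (≈-endpoints e)))))
    rs′ : R (map name (qctx b (transport c ns))) (map name (qctx b′ (transport c′ ns′)))
    rs′ = subst (λ xs → R xs _) (sym (names-transport-qctx ns c))
            (subst (R _) (trans c≡c′ (sym (names-transport-qctx ns′ c′)))
              (permute-Pointwise c rs₀))

  uniqueₑ : ∀ {ρ Γ Γ′ u u′ A} (E : Γ ⊢ₑ u ∶ A) (E′ : Γ′ ⊢ₑ u′ ∶ A) →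
            ρ ⊢ Γ ≈ᶜ Γ′ → ⟦ E ⟧ₑ ≈ ⟦ E′ ⟧ₑ → ρ ⊢ u ≈α u′
  uniqueₑ (𝟙-E ns p E) (𝟙-E ns′ p′ E′) rs e
    with rs₁ , named r , rs₂ ← ≈ᶜ-split ns ns′ 𝟙 𝟙 rs =
    let⋆ (var r) (uniqueₑ E E′ (Pointwise.++⁺ rs₁ rs₂)
      (≈-trans (≈-sym (⟦𝟙-E⟧ ns p E)) (≈-trans e (⟦𝟙-E⟧ ns′ p′ E′))))
  uniqueₑ (⊗-E {a} ns p E) (⊗-E {a′} ns′ p′ E′) rs e
    with rs₁ , named r , rs₂ ← ≈ᶜ-split ns ns′ (_ ⊗ _) (_ ⊗ _) rs
    with x-freshΘ , y≢x ∷ x-freshΔ , q ← distinct-split (qctx a ns) (distinctₑ E)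
       | x-freshΘ′ , y≢x′ ∷ x-freshΔ′ , q′ ← distinct-split (qctx a′ ns′) (distinctₑ E′)
    with y-freshΘ , y-freshΔ , _ ← distinct-split (qctx a ns) q
       | y-freshΘ′ , y-freshΔ′ , _ ← distinct-split (qctx a′ ns′) q′ =
    letp (var r) (uniqueₑ E E′
      (Pointwise.++⁺ (≈ᶜ-bind y-freshΘ y-freshΘ′ (≈ᶜ-bind x-freshΘ x-freshΘ′ rs₁))
        (named (there y≢x y≢x′ here) ∷ named here ∷
          ≈ᶜ-bind y-freshΔ y-freshΔ′ (≈ᶜ-bind x-freshΔ x-freshΔ′ rs₂)))
      (≈-trans (≈-sym (⟦⊗-E⟧ ns p E)) (≈-trans e (⟦⊗-E⟧ ns′ p′ E′))))
  uniqueₑ (□-E {a} ns p E) (□-E {a′} ns′ p′ E′) rs e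
    with rs₁ , named r , rs₂ ← ≈ᶜ-split ns ns′ (□ _ _) (□ _ _) rs
    with x-freshΘ , x-freshΔ , _ ← distinct-split (qctx a ns) (distinctₑ E)
       | x-freshΘ′ , x-freshΔ′ , _ ← distinct-split (qctx a′ ns′) (distinctₑ E′) =
    letbox (var r) (uniqueₑ E E′
      (Pointwise.++⁺ (≈ᶜ-bind x-freshΘ x-freshΘ′ rs₁)
        (named here ∷ ≈ᶜ-bind x-freshΔ x-freshΔ′ rs₂))
      (≈-trans (≈-sym (⟦□-E⟧ ns p E)) (≈-trans e (⟦□-E⟧ ns′ p′ E′))))
  uniqueₑ (circ ns c D) (circ ns′ c′ D′) rs e =
    unique-circ ns ns′ c c′ D D′ rs
      (≈-trans (≈-sym (⟦circ⟧ ns c D)) (≈-trans e (⟦circ⟧ ns′ c′ D′)))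
  uniqueₑ (𝟙-E ns _ _) (⊗-E ns′ _ _) rs e with () ← firstNonQubit-unique ns ns′ rs
  uniqueₑ (𝟙-E ns _ _) (□-E ns′ _ _) rs e with () ← firstNonQubit-unique ns ns′ rs
  uniqueₑ (⊗-E ns _ _) (𝟙-E ns′ _ _) rs e with () ← firstNonQubit-unique ns ns′ rs
  uniqueₑ (⊗-E ns _ _) (□-E ns′ _ _) rs e with () ← firstNonQubit-unique ns ns′ rs
  uniqueₑ (□-E ns _ _) (𝟙-E ns′ _ _) rs e with () ← firstNonQubit-unique ns ns′ rs
  uniqueₑ (□-E ns _ _) (⊗-E ns′ _ _) rs e with () ← firstNonQubit-unique ns ns′ rs
  uniqueₑ (circ ns _ _) (𝟙-E ns′ _ _) rs e
    with () ← firstNonQubit-unique ns ns′ (subst (λ Γ → _ ⊢ Γ ≈ᶜ _) (sym (++-identityʳ _)) rs)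
  uniqueₑ (circ ns _ _) (⊗-E ns′ _ _) rs e
    with () ← firstNonQubit-unique ns ns′ (subst (λ Γ → _ ⊢ Γ ≈ᶜ _) (sym (++-identityʳ _)) rs)
  uniqueₑ (circ ns _ _) (□-E ns′ _ _) rs e
    with () ← firstNonQubit-unique ns ns′ (subst (λ Γ → _ ⊢ Γ ≈ᶜ _) (sym (++-identityʳ _)) rs)
  uniqueₑ (𝟙-E ns _ _) (circ ns′ _ _) rs e
    with () ← firstNonQubit-unique ns ns′ (subst (_ ⊢ _ ≈ᶜ_) (sym (++-identityʳ _)) rs)
  uniqueₑ (⊗-E ns _ _) (circ ns′ _ _) rs e
    with () ← firstNonQubit-unique ns ns′ (subst (_ ⊢ _ ≈ᶜ_) (sym (++-identityʳ _)) rs)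
  uniqueₑ (□-E ns _ _) (circ ns′ _ _) rs e
    with () ← firstNonQubit-unique ns ns′ (subst (_ ⊢ _ ≈ᶜ_) (sym (++-identityʳ _)) rs)

theorem21 : (ℛ : RealNumbers) (𝒮 : GateSet ℛ) → let open Language ℛ 𝒮 in
    {Γ : Context} {t : Term annotated} {A : Type} (D : Γ ⊢ t ∶ A) →
    ∃! _=α_ (λ u → Σ[ E ∈ (Γ ⊢ₑ u ∶ A) ] ⟦ D ⟧ ≈ ⟦ E ⟧ₑ)
theorem21 ℛ 𝒮 {Γ} D =
  let open Circuits ℛ 𝒮
      open Language ℛ 𝒮
      u , E , e = normalise Γ [] [] (distinct D) ⟦ D ⟧
  in u , (E , e) , λ (E′ , e′) → uniqueₑ E E′ (≈ᶜ-refl Γ) (≈-trans (≈-sym e) e′)
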